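{- Let $d\ge 2$ be an integer and $\lambda>0$ a real number. For every finite $d$-regular, vertex-transitive, bipartite (simple) graph $G$, \[ \alpha_G(\lambda)>\alpha_{T_d}(\lambda), \] where $\alpha_G(\lambda)$ is the occupancy fraction of the hard-core model on $G$ at fugacity $\lambda$ and $\alpha_{T_d}(\lambda)$ is the occupancy fraction of the unique translation invariant hard-core measure on the infinite $d$-regular tree $T_d$ at fugacity $\lambda$, that is, the solution $\alpha\in[0,1/2]$ of the equation \[ \frac{\alpha}{\lambda(1-\alpha)}=\left(\frac{1-2\alpha}{1-\alpha}\right)^d . \]
   Context: For a finite graph $G$, let $\mathcal I$ be the set of all independent sets of $G$ (including the empty set), and let $P_G(\lambda)=\sum_{I\in\mathcal I}\lambda^{|I|}$. The hard-core model with fugacity $\lambda$ on $G$ is the random independent set $I$ with $\Pr[I]=\lambda^{|I|}/P_G(\lambda)$. The occupancy fraction is \[ \alpha_G(\lambda)=\frac{1}{|V(G)|}\sum_{v\in V(G)}\Pr[v\in I]=\frac{1}{|V(G)|}\frac{\lambda P_G'(\lambda)}{P_G(\lambda)}. \] The displayed equation in the claim may be taken as the definition of $\alpha_{T_d}(\lambda)$: on $[0,1/2]$ its left side is strictly increasing in $\alpha$ and its right side is strictly decreasing, so there is exactly one solution there. A graph is vertex-transitive if its automorphism group acts transitively on its vertices. -}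

module Defs where

open import Data.Bool.Base using (Bool)
open import Data.Fin.Base using (Fin)
open import Data.Fin.Permutation using (Permutation′; _⟨$⟩ʳ_)
open import Data.Fin.Properties using (all?)
open import Data.Fin.Subset using (Subset; inside; outside; _∈_; ∣_∣) renaming (⊥ to ∅)
open import Data.Fin.Subset.Properties using (_∈?_; ∉⊥)
import Data.Integer.Base as ℤ
open import Data.List.Base using (List; []; _∷_; [_]; _++_; map; filter; allFin)
import Data.List.Membership.Propositional as List
open import Data.List.Membership.Propositional.Properties
  using (∈-filter⁺; ∈-++⁺ʳ; ∈-map⁺)
open import Data.List.Relation.Unary.Any using (here; there)
open import Data.Nat.Base as ℕ using (ℕ; zero; suc; NonZero)
import Data.Nat.Properties as ℕ
open import Data.Product.Base using (Σ-syntax; ∃-syntax; _×_; _,_)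
open import Data.Rational.Base as ℚ using (ℚ; 0ℚ; 1ℚ; mkℚ)
import Data.Rational.Properties as ℚ
open import Data.Rational.Solver using (module +-*-Solver)
open import Data.Vec.Base as Vec using (tabulate)
open import Function.Bundles using (_⇔_)
open import Relation.Binary.Core using (Rel)
open import Relation.Binary.Definitions using (Decidable; Symmetric; Irreflexive)
open import Relation.Binary.PropositionalEquality
  using (_≡_; _≢_; refl; sym; trans; cong; cong₂; subst; module ≡-Reasoning)
open import Relation.Nullary using (¬_; does; contradiction)
open import Relation.Nullary.Decidable using (¬?; _→-dec_)
open import Relation.Unary as Unary using (Pred)
open import Level using (0ℓ)

open +-*-Solver using (solve; _:+_; _:*_; _:-_; :-_; _:=_)

-- Real numbers are Cauchy sequences of rationals, considered up to _≃_.
-- Operations are termwise; _≃_, _<_ and _≤_ only look at tails of sequences.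

Eventually : Pred ℕ 0ℓ → Set
Eventually P = ∃[ N ] (∀ n → N ℕ.≤ n → P n)

IsCauchy : (ℕ → ℚ) → Set
IsCauchy s = ∀ ε → 0ℚ ℚ.< ε →
  ∃[ N ] (∀ m n → N ℕ.≤ m → N ℕ.≤ n → ℚ.∣ s m ℚ.- s n ∣ ℚ.< ε)

record ℝ : Set where
  constructor mkℝ
  field
    seq    : ℕ → ℚ
    cauchy : IsCauchy seq

open ℝ public

infix 4 _≃_ _<_ _≤_

_≃_ : Rel ℝ 0ℓ
x ≃ y = ∀ ε → 0ℚ ℚ.< ε → Eventually λ n → ℚ.∣ seq x n ℚ.- seq y n ∣ ℚ.< ε

_<_ : Rel ℝ 0ℓ
x < y = ∃[ ε ] (0ℚ ℚ.< ε × Eventually λ n → seq x n ℚ.+ ε ℚ.≤ seq y n)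

_≤_ : Rel ℝ 0ℓ
x ≤ y = ∀ ε → 0ℚ ℚ.< ε → Eventually λ n → seq x n ℚ.≤ seq y n ℚ.+ ε

-- Totalised so that reciprocals can be taken termwise: a positive real may
-- have finitely many zero terms.
recip : ℚ → ℚ
recip   (mkℚ ℤ.+0       _ _) = 0ℚ
recip p@(mkℚ ℤ.+[1+ _ ] _ _) = ℚ.1/ p
recip p@(mkℚ ℤ.-[1+ _ ] _ _) = ℚ.1/ p

private
  recip-inverseʳ : ∀ {p} → 0ℚ ℚ.< p → p ℚ.* recip p ≡ 1ℚ
  recip-inverseʳ {p@(mkℚ ℤ.+[1+ _ ] _ _)} 0<p = ℚ.*-inverseʳ p
  recip-inverseʳ {mkℚ ℤ.+0 _ _}       0<p with () ← ℚ.positive 0<p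
  recip-inverseʳ {mkℚ ℤ.-[1+ _ ] _ _} 0<p with () ← ℚ.positive 0<p

  recip-pos : ∀ {p} → 0ℚ ℚ.< p → 0ℚ ℚ.< recip p
  recip-pos {p@(mkℚ ℤ.+[1+ _ ] _ _)} 0<p = ℚ.positive⁻¹ (ℚ.1/ p) {{ℚ.1/pos⇒pos p}}
  recip-pos {mkℚ ℤ.+0 _ _}       0<p with () ← ℚ.positive 0<p
  recip-pos {mkℚ ℤ.-[1+ _ ] _ _} 0<p with () ← ℚ.positive 0<p

  *-pos : ∀ {p q} → 0ℚ ℚ.< p → 0ℚ ℚ.< q → 0ℚ ℚ.< p ℚ.* q
  *-pos {p} {q} 0<p 0<q = subst (ℚ._< p ℚ.* q) (ℚ.*-zeroʳ p)
    (ℚ.*-monoʳ-<-pos p {{ℚ.positive 0<p}} 0<q)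

  half-pos : ∀ {p} → 0ℚ ℚ.< p → 0ℚ ℚ.< ℚ.½ ℚ.* p
  half-pos = *-pos (ℚ.positive⁻¹ ℚ.½)

  half+half : ∀ p → ℚ.½ ℚ.* p ℚ.+ ℚ.½ ℚ.* p ≡ p
  half+half p = trans (sym (ℚ.*-distribʳ-+ p ℚ.½ ℚ.½)) (ℚ.*-identityˡ p)

  *-mono-≤-< : ∀ {a b c d} → 0ℚ ℚ.< b → 0ℚ ℚ.≤ c → a ℚ.≤ b → c ℚ.< d →
               a ℚ.* c ℚ.< b ℚ.* d
  *-mono-≤-< {a} {b} {c} {d} 0<b 0≤c a≤b c<d = ℚ.≤-<-trans
    (ℚ.*-monoʳ-≤-nonNeg c {{ℚ.nonNegative 0≤c}} a≤b)
    (ℚ.*-monoʳ-<-pos b {{ℚ.positive 0<b}} c<d)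

  *-mono-≤₂ : ∀ {a b c d} → 0ℚ ℚ.≤ a → 0ℚ ℚ.≤ d → a ℚ.≤ b → c ℚ.≤ d →
              a ℚ.* c ℚ.≤ b ℚ.* d
  *-mono-≤₂ {a} {b} {c} {d} 0≤a 0≤d a≤b c≤d = ℚ.≤-trans
    (ℚ.*-monoˡ-≤-nonNeg a {{ℚ.nonNegative 0≤a}} c≤d)
    (ℚ.*-monoʳ-≤-nonNeg d {{ℚ.nonNegative 0≤d}} a≤b)

  bounded : ∀ {s} → IsCauchy s →
            ∃[ B ] (0ℚ ℚ.< B × Eventually λ n → ℚ.∣ s n ∣ ℚ.≤ B)
  bounded {s} c with N , close ← c 1ℚ (ℚ.positive⁻¹ 1ℚ) =
    1ℚ ℚ.+ ℚ.∣ s N ∣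
    , ℚ.<-≤-trans (ℚ.positive⁻¹ 1ℚ) (subst (ℚ._≤ 1ℚ ℚ.+ ℚ.∣ s N ∣) (ℚ.+-identityʳ 1ℚ)
        (ℚ.+-monoʳ-≤ 1ℚ (ℚ.0≤∣p∣ (s N))))
    , N , λ n N≤n → begin
        ℚ.∣ s n ∣                           ≡⟨ cong ℚ.∣_∣ (split (s n) (s N)) ⟩
        ℚ.∣ (s n ℚ.- s N) ℚ.+ s N ∣         ≤⟨ ℚ.∣p+q∣≤∣p∣+∣q∣ (s n ℚ.- s N) (s N) ⟩
        ℚ.∣ s n ℚ.- s N ∣ ℚ.+ ℚ.∣ s N ∣     ≤⟨ ℚ.+-monoˡ-≤ ℚ.∣ s N ∣ (ℚ.<⇒≤ (close n N N≤n ℕ.≤-refl)) ⟩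
        1ℚ ℚ.+ ℚ.∣ s N ∣                    ∎
    where
    open ℚ.≤-Reasoning
    split : ∀ a b → a ≡ (a ℚ.- b) ℚ.+ b
    split = solve 2 (λ a b → a := (a :- b) :+ b) refl

fromℚ : ℚ → ℝ
fromℚ q = mkℝ (λ _ → q) λ ε 0<ε → 0 , λ _ _ _ _ →
  subst (λ r → ℚ.∣ r ∣ ℚ.< ε) (sym (ℚ.+-inverseʳ q)) 0<ε

fromℕ : ℕ → ℝ
fromℕ n = fromℚ (ℤ.+ n ℚ./ 1)

0ℝ 1ℝ 2ℝ ½ : ℝ
0ℝ = fromℚ 0ℚ
1ℝ = fromℚ 1ℚ
2ℝ = fromℕ 2
½  = fromℚ ℚ.½

infixl 6 _+_ _-_
infixl 7 _*_ _/_[_]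
infixr 8 _^_ _⁻¹[_]
infix  8 -_

_+_ : ℝ → ℝ → ℝ
seq    (x + y) n = seq x n ℚ.+ seq y n
cauchy (x + y) ε 0<ε
  with N , closeˣ ← cauchy x (ℚ.½ ℚ.* ε) (half-pos 0<ε)
     | M , closeʸ ← cauchy y (ℚ.½ ℚ.* ε) (half-pos 0<ε)
  = N ℕ.⊔ M , λ m n ≤m ≤n → begin-strict
    ℚ.∣ (s m ℚ.+ t m) ℚ.- (s n ℚ.+ t n) ∣
      ≡⟨ cong ℚ.∣_∣ (regroup (s m) (t m) (s n) (t n)) ⟩
    ℚ.∣ (s m ℚ.- s n) ℚ.+ (t m ℚ.- t n) ∣
      ≤⟨ ℚ.∣p+q∣≤∣p∣+∣q∣ (s m ℚ.- s n) (t m ℚ.- t n) ⟩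
    ℚ.∣ s m ℚ.- s n ∣ ℚ.+ ℚ.∣ t m ℚ.- t n ∣
      <⟨ ℚ.+-mono-< (closeˣ m n (ℕ.m⊔n≤o⇒m≤o N M ≤m) (ℕ.m⊔n≤o⇒m≤o N M ≤n))
                    (closeʸ m n (ℕ.m⊔n≤o⇒n≤o N M ≤m) (ℕ.m⊔n≤o⇒n≤o N M ≤n)) ⟩
    ℚ.½ ℚ.* ε ℚ.+ ℚ.½ ℚ.* ε
      ≡⟨ half+half ε ⟩
    ε ∎
  where
  open ℚ.≤-Reasoning
  s = seq x
  t = seq y
  regroup : ∀ a b c d → (a ℚ.+ b) ℚ.- (c ℚ.+ d) ≡ (a ℚ.- c) ℚ.+ (b ℚ.- d)
  regroup = solve 4 (λ a b c d → (a :+ b) :- (c :+ d) := (a :- c) :+ (b :- d)) refl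

-_ : ℝ → ℝ
seq    (- x) n = ℚ.- seq x n
cauchy (- x) ε 0<ε with N , close ← cauchy x ε 0<ε =
  N , λ m n ≤m ≤n → subst (ℚ._< ε)
    (trans (sym (ℚ.∣-p∣≡∣p∣ (seq x m ℚ.- seq x n)))
           (cong ℚ.∣_∣ (neg (seq x m) (seq x n))))
    (close m n ≤m ≤n)
  where
  neg : ∀ a b → ℚ.- (a ℚ.- b) ≡ (ℚ.- a) ℚ.- (ℚ.- b)
  neg = solve 2 (λ a b → :- (a :- b) := (:- a) :- (:- b)) refl

_-_ : ℝ → ℝ → ℝ
x - y = x + - y

private
  recip-cancel : ∀ p q → 0ℚ ℚ.< p → p ℚ.* (recip p ℚ.* q) ≡ q
  recip-cancel p q 0<p = trans (sym (ℚ.*-assoc p (recip p) q))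
    (trans (cong (ℚ._* q) (recip-inverseʳ 0<p)) (ℚ.*-identityˡ q))

  *-diff : ∀ a b c d → a ℚ.* b ℚ.- c ℚ.* d ≡ a ℚ.* (b ℚ.- d) ℚ.+ d ℚ.* (a ℚ.- c)
  *-diff = solve 4 (λ a b c d → a :* b :- c :* d := a :* (b :- d) :+ d :* (a :- c)) refl

  *-close : ∀ B C δ a b c d → 0ℚ ℚ.< B → 0ℚ ℚ.< C → ℚ.∣ a ∣ ℚ.≤ B → ℚ.∣ d ∣ ℚ.≤ C →
            ℚ.∣ b ℚ.- d ∣ ℚ.< recip B ℚ.* δ → ℚ.∣ a ℚ.- c ∣ ℚ.< recip C ℚ.* δ →
            ℚ.∣ a ℚ.* b ℚ.- c ℚ.* d ∣ ℚ.< δ ℚ.+ δ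
  *-close B C δ a b c d 0<B 0<C a≤B d≤C b~d a~c = begin-strict
    ℚ.∣ a ℚ.* b ℚ.- c ℚ.* d ∣
      ≡⟨ cong ℚ.∣_∣ (*-diff a b c d) ⟩
    ℚ.∣ a ℚ.* (b ℚ.- d) ℚ.+ d ℚ.* (a ℚ.- c) ∣
      ≤⟨ ℚ.∣p+q∣≤∣p∣+∣q∣ (a ℚ.* (b ℚ.- d)) (d ℚ.* (a ℚ.- c)) ⟩
    ℚ.∣ a ℚ.* (b ℚ.- d) ∣ ℚ.+ ℚ.∣ d ℚ.* (a ℚ.- c) ∣
      ≡⟨ cong₂ ℚ._+_ (ℚ.∣p*q∣≡∣p∣*∣q∣ a (b ℚ.- d)) (ℚ.∣p*q∣≡∣p∣*∣q∣ d (a ℚ.- c)) ⟩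
    ℚ.∣ a ∣ ℚ.* ℚ.∣ b ℚ.- d ∣ ℚ.+ ℚ.∣ d ∣ ℚ.* ℚ.∣ a ℚ.- c ∣
      <⟨ ℚ.+-mono-<
           (*-mono-≤-< {ℚ.∣ a ∣} {B} {ℚ.∣ b ℚ.- d ∣} {recip B ℚ.* δ} 0<B (ℚ.0≤∣p∣ (b ℚ.- d)) a≤B b~d)
           (*-mono-≤-< {ℚ.∣ d ∣} {C} {ℚ.∣ a ℚ.- c ∣} {recip C ℚ.* δ} 0<C (ℚ.0≤∣p∣ (a ℚ.- c)) d≤C a~c) ⟩
    B ℚ.* (recip B ℚ.* δ) ℚ.+ C ℚ.* (recip C ℚ.* δ)
      ≡⟨ cong₂ ℚ._+_ (recip-cancel B δ 0<B) (recip-cancel C δ 0<C) ⟩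
    δ ℚ.+ δ ∎
    where open ℚ.≤-Reasoning

  *-cauchy : ∀ s t → IsCauchy s → IsCauchy t → IsCauchy (λ n → s n ℚ.* t n)
  *-cauchy s t cs ct ε 0<ε =
    let δ = ℚ.½ ℚ.* ε
        B , 0<B , N₁ , bndˢ = bounded cs
        C , 0<C , N₂ , bndᵗ = bounded ct
        N₃ , closeˢ = cs (recip C ℚ.* δ) (*-pos {recip C} {δ} (recip-pos 0<C) (half-pos {ε} 0<ε))
        N₄ , closeᵗ = ct (recip B ℚ.* δ) (*-pos {recip B} {δ} (recip-pos 0<B) (half-pos {ε} 0<ε))
    in N₁ ℕ.⊔ N₂ ℕ.⊔ (N₃ ℕ.⊔ N₄) , λ m n ≤m ≤n →
    let ≤m₁₂ = ℕ.m⊔n≤o⇒m≤o (N₁ ℕ.⊔ N₂) (N₃ ℕ.⊔ N₄) ≤m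
        ≤n₁₂ = ℕ.m⊔n≤o⇒m≤o (N₁ ℕ.⊔ N₂) (N₃ ℕ.⊔ N₄) ≤n
        ≤m₃₄ = ℕ.m⊔n≤o⇒n≤o (N₁ ℕ.⊔ N₂) (N₃ ℕ.⊔ N₄) ≤m
        ≤n₃₄ = ℕ.m⊔n≤o⇒n≤o (N₁ ℕ.⊔ N₂) (N₃ ℕ.⊔ N₄) ≤n
    in subst (ℚ.∣ s m ℚ.* t m ℚ.- s n ℚ.* t n ∣ ℚ.<_) (half+half ε)
         (*-close B C δ (s m) (t m) (s n) (t n) 0<B 0<C
           (bndˢ m (ℕ.m⊔n≤o⇒m≤o N₁ N₂ ≤m₁₂))
           (bndᵗ n (ℕ.m⊔n≤o⇒n≤o N₁ N₂ ≤n₁₂))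
           (closeᵗ m n (ℕ.m⊔n≤o⇒n≤o N₃ N₄ ≤m₃₄) (ℕ.m⊔n≤o⇒n≤o N₃ N₄ ≤n₃₄))
           (closeˢ m n (ℕ.m⊔n≤o⇒m≤o N₃ N₄ ≤m₃₄) (ℕ.m⊔n≤o⇒m≤o N₃ N₄ ≤n₃₄)))

_*_ : ℝ → ℝ → ℝ
seq    (x * y) n = seq x n ℚ.* seq y n
cauchy (x * y)   = *-cauchy (seq x) (seq y) (cauchy x) (cauchy y)

_^_ : ℝ → ℕ → ℝ
x ^ zero  = 1ℝ
x ^ suc k = x * x ^ k

private
  -- If 0 < δ ≤ a, b then |1/a − 1/b| = |b − a| · (1/a · 1/b) ≤ |b − a| · (1/δ)².
  recip-antimono : ∀ {δ a} → 0ℚ ℚ.< δ → δ ℚ.≤ a → recip a ℚ.≤ recip δ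
  recip-antimono {δ} {a} 0<δ δ≤a = begin
    recip a                          ≡⟨ ℚ.*-identityˡ (recip a) ⟨
    1ℚ ℚ.* recip a                   ≡⟨ cong (ℚ._* recip a) (recip-inverseʳ 0<δ) ⟨
    δ ℚ.* recip δ ℚ.* recip a        ≡⟨ swap δ (recip δ) (recip a) ⟩
    recip δ ℚ.* recip a ℚ.* δ        ≤⟨ ℚ.*-monoˡ-≤-nonNeg (recip δ ℚ.* recip a)
                                          {{ℚ.nonNegative (ℚ.<⇒≤ (*-pos (recip-pos 0<δ) (recip-pos 0<a)))}} δ≤a ⟩
    recip δ ℚ.* recip a ℚ.* a        ≡⟨ swap′ (recip δ) (recip a) a ⟩
    recip δ ℚ.* (a ℚ.* recip a)      ≡⟨ cong (recip δ ℚ.*_) (recip-inverseʳ 0<a) ⟩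
    recip δ ℚ.* 1ℚ                   ≡⟨ ℚ.*-identityʳ (recip δ) ⟩
    recip δ                          ∎
    where
    open ℚ.≤-Reasoning
    0<a = ℚ.<-≤-trans 0<δ δ≤a
    swap : ∀ d r s → d ℚ.* r ℚ.* s ≡ r ℚ.* s ℚ.* d
    swap = solve 3 (λ d r s → d :* r :* s := r :* s :* d) refl
    swap′ : ∀ r s a → r ℚ.* s ℚ.* a ≡ r ℚ.* (a ℚ.* s)
    swap′ = solve 3 (λ r s a → r :* s :* a := r :* (a :* s)) refl

  recip-diff : ∀ {a b} → 0ℚ ℚ.< a → 0ℚ ℚ.< b →
               recip a ℚ.- recip b ≡ (recip a ℚ.* recip b) ℚ.* (b ℚ.- a)
  recip-diff {a} {b} 0<a 0<b = sym (begin
    (recip a ℚ.* recip b) ℚ.* (b ℚ.- a)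
      ≡⟨ expand a b (recip a) (recip b) ⟩
    recip a ℚ.* (b ℚ.* recip b) ℚ.- recip b ℚ.* (a ℚ.* recip a)
      ≡⟨ cong₂ (λ u v → recip a ℚ.* u ℚ.- recip b ℚ.* v) (recip-inverseʳ 0<b) (recip-inverseʳ 0<a) ⟩
    recip a ℚ.* 1ℚ ℚ.- recip b ℚ.* 1ℚ
      ≡⟨ cong₂ ℚ._-_ (ℚ.*-identityʳ (recip a)) (ℚ.*-identityʳ (recip b)) ⟩
    recip a ℚ.- recip b ∎)
    where
    open ≡-Reasoning
    expand : ∀ a b r s → (r ℚ.* s) ℚ.* (b ℚ.- a) ≡ r ℚ.* (b ℚ.* s) ℚ.- s ℚ.* (a ℚ.* r)
    expand = solve 4 (λ a b r s → (r :* s) :* (b :- a) := r :* (b :* s) :- s :* (a :* r)) refl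

  recip-close : ∀ δ ε a b → 0ℚ ℚ.< δ → δ ℚ.≤ a → δ ℚ.≤ b →
                ℚ.∣ b ℚ.- a ∣ ℚ.< δ ℚ.* δ ℚ.* ε → ℚ.∣ recip a ℚ.- recip b ∣ ℚ.< ε
  recip-close δ ε a b 0<δ δ≤a δ≤b b~a = begin-strict
    ℚ.∣ recip a ℚ.- recip b ∣
      ≡⟨ cong ℚ.∣_∣ (recip-diff {a} {b} 0<a 0<b) ⟩
    ℚ.∣ r ℚ.* (b ℚ.- a) ∣
      ≡⟨ ℚ.∣p*q∣≡∣p∣*∣q∣ r (b ℚ.- a) ⟩
    ℚ.∣ r ∣ ℚ.* ℚ.∣ b ℚ.- a ∣
      ≡⟨ cong (ℚ._* ℚ.∣ b ℚ.- a ∣) (ℚ.0≤p⇒∣p∣≡p {r} (ℚ.<⇒≤ {0ℚ} {r} 0<r)) ⟩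
    r ℚ.* ℚ.∣ b ℚ.- a ∣
      <⟨ *-mono-≤-< {r} {u ℚ.* u} {ℚ.∣ b ℚ.- a ∣} {δ ℚ.* δ ℚ.* ε}
           (*-pos {u} {u} 0<u 0<u) (ℚ.0≤∣p∣ (b ℚ.- a))
           (*-mono-≤₂ {recip a} {u} {recip b} {u}
             (ℚ.<⇒≤ {0ℚ} {recip a} (recip-pos 0<a)) (ℚ.<⇒≤ {0ℚ} {u} 0<u)
             (recip-antimono 0<δ δ≤a) (recip-antimono 0<δ δ≤b))
           b~a ⟩
    (u ℚ.* u) ℚ.* (δ ℚ.* δ ℚ.* ε)
      ≡⟨ regroup δ u ε ⟩
    (δ ℚ.* u) ℚ.* (δ ℚ.* u) ℚ.* ε
      ≡⟨ cong (λ t → t ℚ.* t ℚ.* ε) (recip-inverseʳ 0<δ) ⟩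
    1ℚ ℚ.* 1ℚ ℚ.* ε
      ≡⟨ ℚ.*-identityˡ ε ⟩
    ε ∎
    where
    open ℚ.≤-Reasoning
    0<a : 0ℚ ℚ.< a
    0<a = ℚ.<-≤-trans 0<δ δ≤a
    0<b : 0ℚ ℚ.< b
    0<b = ℚ.<-≤-trans 0<δ δ≤b
    r u : ℚ
    r = recip a ℚ.* recip b
    u = recip δ
    0<u : 0ℚ ℚ.< u
    0<u = recip-pos 0<δ
    0<r : 0ℚ ℚ.< r
    0<r = *-pos {recip a} {recip b} (recip-pos 0<a) (recip-pos 0<b)
    regroup : ∀ d r e → (r ℚ.* r) ℚ.* (d ℚ.* d ℚ.* e) ≡ (d ℚ.* r) ℚ.* (d ℚ.* r) ℚ.* e
    regroup = solve 3 (λ d r e → (r :* r) :* (d :* d :* e) := (d :* r) :* (d :* r) :* e) refl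

  recip-cauchy : ∀ s → IsCauchy s → ∀ δ → 0ℚ ℚ.< δ → Eventually (λ n → 0ℚ ℚ.+ δ ℚ.≤ s n) →
                 IsCauchy (λ n → recip (s n))
  recip-cauchy s cs δ 0<δ (N₁ , δ≤) ε 0<ε =
    let N₂ , close = cs (δ ℚ.* δ ℚ.* ε) (*-pos {δ ℚ.* δ} {ε} (*-pos {δ} {δ} 0<δ 0<δ) 0<ε)
    in N₁ ℕ.⊔ N₂ , λ m n ≤m ≤n → recip-close δ ε (s m) (s n) 0<δ
         (bound m (ℕ.m⊔n≤o⇒m≤o N₁ N₂ ≤m)) (bound n (ℕ.m⊔n≤o⇒m≤o N₁ N₂ ≤n))
         (close n m (ℕ.m⊔n≤o⇒n≤o N₁ N₂ ≤n) (ℕ.m⊔n≤o⇒n≤o N₁ N₂ ≤m))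
    where
    bound : ∀ n → N₁ ℕ.≤ n → δ ℚ.≤ s n
    bound n N₁≤n = subst (ℚ._≤ s n) (ℚ.+-identityˡ δ) (δ≤ n N₁≤n)

_⁻¹[_] : (x : ℝ) → 0ℝ < x → ℝ
seq    (x ⁻¹[ _ ]) n = recip (seq x n)
cauchy (x ⁻¹[ δ , 0<δ , x≥δ ]) = recip-cauchy (seq x) (cauchy x) δ 0<δ x≥δ

_/_[_] : (x y : ℝ) → 0ℝ < y → ℝ
x / y [ y>0 ] = x * y ⁻¹[ y>0 ]

∑[_] : ∀ {A : Set} → List A → (A → ℝ) → ℝ
∑[ []     ] f = 0ℝ
∑[ x ∷ xs ] f = f x + ∑[ xs ] f

0<1 : 0ℝ < 1ℝ
0<1 = 1ℚ , ℚ.positive⁻¹ 1ℚ , 0 , λ _ _ → ℚ.≤-refl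

0<fromℕ : ∀ n .{{_ : NonZero n}} → 0ℝ < fromℕ n
0<fromℕ n@(suc _) = q , ℚ.positive⁻¹ q {{ℚ.normalize-pos n 1}} , 0 , λ _ _ → ℚ.≤-reflexive (ℚ.+-identityˡ q)
  where q = ℤ.+ n ℚ./ 1

0<x*y : ∀ {x y} → 0ℝ < x → 0ℝ < y → 0ℝ < x * y
0<x*y {x} {y} (ε , 0<ε , N , p) (δ , 0<δ , M , q) =
  ε ℚ.* δ , *-pos 0<ε 0<δ , N ℕ.⊔ M , λ n ≤n →
    let ε≤ = subst (ℚ._≤ seq x n) (ℚ.+-identityˡ ε) (p n (ℕ.m⊔n≤o⇒m≤o N M ≤n))
        δ≤ = subst (ℚ._≤ seq y n) (ℚ.+-identityˡ δ) (q n (ℕ.m⊔n≤o⇒n≤o N M ≤n))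
    in subst (ℚ._≤ seq x n ℚ.* seq y n) (sym (ℚ.+-identityˡ (ε ℚ.* δ)))
         (*-mono-≤₂ (ℚ.<⇒≤ 0<ε) (ℚ.<⇒≤ (ℚ.<-≤-trans 0<δ δ≤)) ε≤ δ≤)

0<x^k : ∀ {x} → 0ℝ < x → ∀ k → 0ℝ < x ^ k
0<x^k         0<x zero    = 0<1
0<x^k {x = x} 0<x (suc k) = 0<x*y {x} {x ^ k} 0<x (0<x^k {x} 0<x k)

0<x+y : ∀ {x y} → 0ℝ < x → 0ℝ < y → 0ℝ < x + y
0<x+y {x} {y} (ε , 0<ε , N , p) (δ , 0<δ , M , q) =
  ε ℚ.+ δ , ℚ.+-mono-< 0<ε 0<δ , N ℕ.⊔ M , λ n ≤n →
    subst (ℚ._≤ seq x n ℚ.+ seq y n) (regroup ε δ)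
      (ℚ.+-mono-≤ (p n (ℕ.m⊔n≤o⇒m≤o N M ≤n)) (q n (ℕ.m⊔n≤o⇒n≤o N M ≤n)))
  where
  regroup : ∀ e d → (0ℚ ℚ.+ e) ℚ.+ (0ℚ ℚ.+ d) ≡ 0ℚ ℚ.+ (e ℚ.+ d)
  regroup e d = trans (cong₂ ℚ._+_ (ℚ.+-identityˡ e) (ℚ.+-identityˡ d)) (sym (ℚ.+-identityˡ (e ℚ.+ d)))

0<∑ : ∀ {A : Set} {f : A → ℝ} {xs x} → x List.∈ xs → (∀ y → 0ℝ < f y) → 0ℝ < ∑[ xs ] f
0<∑ {f = f} {x ∷ []} _ pos with ε , 0<ε , N , p ← pos x =
  ε , 0<ε , N , λ n N≤n →
    subst (0ℚ ℚ.+ ε ℚ.≤_) (sym (ℚ.+-identityʳ (seq (f x) n))) (p n N≤n)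
0<∑ {f = f} {x ∷ y ∷ ys} _ pos =
  0<x+y {f x} {∑[ y ∷ ys ] f} (pos x) (0<∑ {f = f} {y ∷ ys} (here refl) pos)

private
  ¼ : ℚ
  ¼ = ℤ.+ 1 ℚ./ 4

0<1-α : ∀ {α} → α ≤ ½ → 0ℝ < 1ℝ - α
0<1-α α≤½ with N , p ← α≤½ ¼ (ℚ.positive⁻¹ ¼) =
  ¼ , ℚ.positive⁻¹ ¼ , N , λ n N≤n → ℚ.+-monoʳ-≤ 1ℚ (ℚ.neg-antimono-≤ (p n N≤n))

record Graph (n : ℕ) : Set₁ where
  infix 4 _~_ _~?_
  field
    _~_    : Rel (Fin n) 0ℓ
    _~?_   : Decidable _~_
    sym-~  : Symmetric _~_
    irrefl : Irreflexive _≡_ _~_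

  neighbours : Fin n → Subset n
  neighbours v = tabulate λ u → does (v ~? u)

  Regular : ℕ → Set
  Regular d = ∀ v → ∣ neighbours v ∣ ≡ d

  Bipartite : Set
  Bipartite = Σ[ side ∈ (Fin n → Bool) ] (∀ u v → u ~ v → side u ≢ side v)

  IsAutomorphism : Permutation′ n → Set
  IsAutomorphism σ = ∀ u v → u ~ v ⇔ (σ ⟨$⟩ʳ u) ~ (σ ⟨$⟩ʳ v)

  VertexTransitive : Set
  VertexTransitive = ∀ u v → Σ[ σ ∈ Permutation′ n ] (IsAutomorphism σ × σ ⟨$⟩ʳ u ≡ v)

  Independent : Subset n → Set
  Independent I = ∀ u v → u ∈ I → v ∈ I → ¬ u ~ v

  independent? : Unary.Decidable Independent
  independent? I = all? λ u → all? λ v →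
    (u ∈? I) →-dec ((v ∈? I) →-dec ¬? (u ~? v))

allSubsets : ∀ n → List (Subset n)
allSubsets zero    = [ Vec.[] ]
allSubsets (suc n) = map (inside Vec.∷_) (allSubsets n) ++ map (outside Vec.∷_) (allSubsets n)

∅∈allSubsets : ∀ n → ∅ List.∈ allSubsets n
∅∈allSubsets zero    = here refl
∅∈allSubsets (suc n) =
  ∈-++⁺ʳ (map (inside Vec.∷_) (allSubsets n)) (∈-map⁺ (outside Vec.∷_) (∅∈allSubsets n))

module HardCore {n : ℕ} (G : Graph n) (z : ℝ) (z>0 : 0ℝ < z) where
  open Graph G

  independentSets : List (Subset n)
  independentSets = filter independent? (allSubsets n)

  weight : Subset n → ℝ
  weight I = z ^ ∣ I ∣

  partitionFunction : ℝ
  partitionFunction = ∑[ independentSets ] weight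

  0<partitionFunction : 0ℝ < partitionFunction
  0<partitionFunction = 0<∑
    (∈-filter⁺ independent? (∅∈allSubsets n) (λ _ _ u∈∅ → contradiction u∈∅ ∉⊥))
    (λ I → 0<x^k {z} z>0 ∣ I ∣)

  Pr : ∀ {A : Pred (Subset n) 0ℓ} → Unary.Decidable A → ℝ
  Pr A? = ∑[ filter A? independentSets ] weight / partitionFunction [ 0<partitionFunction ]

  occupancyFraction : .{{_ : NonZero n}} → ℝ
  occupancyFraction = ∑[ allFin n ] (λ v → Pr (v ∈?_)) / fromℕ n [ 0<fromℕ n ]

-- The occupancy fraction of the unique translation invariant hard-core measure
-- at fugacity z on the infinite d-regular tree is the solution α ∈ [0, ½] of
-- this equation (unique up to _≃_: the left side increases and the right side
-- decreases in α).

record IsTreeOccupancy (d : ℕ) (z : ℝ) (z>0 : 0ℝ < z) (α : ℝ) : Set where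
  field
    0≤α : 0ℝ ≤ α
    α≤½ : α ≤ ½

  1-α>0 : 0ℝ < 1ℝ - α
  1-α>0 = 0<1-α {α} α≤½

  z[1-α]>0 : 0ℝ < z * (1ℝ - α)
  z[1-α]>0 = 0<x*y {z} {1ℝ - α} z>0 1-α>0

  field
    equation : α / (z * (1ℝ - α)) [ z[1-α]>0 ]
             ≃ ((1ℝ - 2ℝ * α) / (1ℝ - α) [ 1-α>0 ]) ^ d

{-# OPTIONS --safe #-}
module Submission where

-- Let a be the occupancy fraction, P the partition function, and condition on a
-- fixed vertex v being unoccupied. Then v can be added to I exactly when none of
-- its d neighbours is occupied, so a / (z (1 − a)) is the conditional probability
-- that all neighbours are unoccupied. By vertex-transitivity each single neighbour
-- is unoccupied with conditional probability (1 − 2a) / (1 − a). In a bipartite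
-- graph vertices on the same side are positively correlated, so
--
--     a / (z (1 − a)) ≥ ((1 − 2a) / (1 − a))ᵈ,
--
-- and monotonicity of both sides gives a ≥ α.
--
-- The correlation inequality is proved by induction on the vertex set, deleting u:
-- the correlation of u and w is a telescoping sum of correlations of w with the
-- neighbours of u, each of the opposite sign. It is strict as soon as u and w are
-- connected. The component of a neighbour u of v in G − v does contain a second
-- neighbour of v, since otherwise counting its edges from both sides would show
-- that d divides 1.
--
-- All quantities are evaluated at the rational terms of the sequence z, which
-- eventually lie in an interval [δ, b] with δ > 0; strictness in the limit requires
-- every strict inequality to hold with a gap that is uniform over that interval.

open import Data.Bool.Base using (Bool; true; false; not; _∧_; if_then_else_)
import Data.Bool.Properties as Bool
open import Data.Fin.Base using (Fin; zero; suc)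
open import Data.Fin.Permutation using (Permutation′; _⟨$⟩ʳ_; _⟨$⟩ˡ_; inverseʳ; inverseˡ)
open import Data.Fin.Properties using (_≟_; any?)
import Data.Integer.Base as ℤ
import Data.Integer.Properties as ℤ
open import Data.List.Base
  using (List; []; _∷_; _++_; map; filter; foldr; length;
    allFin) renaming (tabulate to tabulateList)
import Data.List.Membership.Propositional as List
open import Data.List.Membership.Propositional.Properties using (∈-filter⁺; ∈-filter⁻; ∈-allFin)
open import Data.List.Properties using (length-tabulate)
open import Data.List.Relation.Unary.Any as Any using (here; there)
import Data.Nat.Coprimality as ℕ
open import Data.Nat.Divisibility using (_∣_; ∣m+n∣m⇒∣n; ∣1⇒≡1; n∣m*n)
import Data.Nat.Properties as ℕ
open import Data.Product.Base using (∃-syntax; _×_; _,_; proj₁; proj₂)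
import Data.Rational.Base as ℚ
import Data.Rational.Properties as ℚ
open import Data.Rational.Solver using (module +-*-Solver)
open import Data.Sum.Base as Sum using (_⊎_; inj₁; inj₂)
open import Data.Vec.Base as Vec using (lookup; tabulate; _[_]≔_)
open import Data.Vec.Properties
  using ([]=⇒lookup; lookup⇒[]=; lookup∘tabulate; []≔-updates; []≔-minimal; lookup∘update′)
open import Function.Base using (_∘_; id)
open import Function.Bundles using (_⇔_; mk⇔; Equivalence)
open import Level using (0ℓ)
open import Relation.Binary.PropositionalEquality
  using (_≡_; _≢_; refl; sym; trans; cong; cong₂; subst; subst₂; module ≡-Reasoning)
open import Relation.Nullary using (¬_; Dec; yes; no; does; contradiction)
open import Relation.Nullary.Decidable using (_×-dec_; ¬?; map′; does-⇔; dec-true; dec-false)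
open import Relation.Unary using (Pred; Decidable)
open import Data.Nat.Base as ℕ using (ℕ; zero; suc; NonZero)
open import Algebra.Properties.Group ℚ.+-0-group using () renaming (∙-cancelʳ to +-cancelʳ)
open import Algebra.Properties.Semiring.Sum ℕ.+-*-semiring
  using (sum; sum-cong-≗; ∑-comm; *-distribˡ-sum; *-distribʳ-sum;
    sum-replicate-zero) renaming (∑-distrib-+ to sum-distrib-+)
open +-*-Solver using (solve; _:+_; _:*_; _:-_; :-_; _:=_; con)

-- Rational estimates for powers, reciprocals and odds.

module Rationals where

  open import Data.Integer.Base using (+[1+_]; +0; -[1+_])
  open import Data.Rational.Base
  open import Data.Rational.Properties
  open import Defs using (recip)

  infixr 8 _^_

  _^_ : ℚ → ℕ → ℚ
  p ^ zero  = 1ℚ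
  p ^ suc k = p * p ^ k

  0<1 : 0ℚ < 1ℚ
  0<1 = positive⁻¹ 1ℚ

  *-pos : ∀ {p q} → 0ℚ < p → 0ℚ < q → 0ℚ < p * q
  *-pos {p} {q} 0<p 0<q =
    subst (_< p * q) (*-zeroʳ p) (*-monoʳ-<-pos p {{positive 0<p}} 0<q)

  *-nonNeg : ∀ {p q} → 0ℚ ≤ p → 0ℚ ≤ q → 0ℚ ≤ p * q
  *-nonNeg {p} {q} 0≤p 0≤q =
    subst (_≤ p * q) (*-zeroʳ p) (*-monoˡ-≤-nonNeg p {{nonNegative 0≤p}} 0≤q)

  +-nonNeg : ∀ {p q} → 0ℚ ≤ p → 0ℚ ≤ q → 0ℚ ≤ p + q
  +-nonNeg = +-mono-≤

  p≤p+q : ∀ p {q} → 0ℚ ≤ q → p ≤ p + q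
  p≤p+q p {q} 0≤q = subst (_≤ p + q) (+-identityʳ p) (+-monoʳ-≤ p 0≤q)

  *-mono-≤ : ∀ {a b c d} → 0ℚ ≤ a → 0ℚ ≤ d → a ≤ b → c ≤ d → a * c ≤ b * d
  *-mono-≤ {a} {b} {c} {d} 0≤a 0≤d a≤b c≤d = ≤-trans
    (*-monoˡ-≤-nonNeg a {{nonNegative 0≤a}} c≤d)
    (*-monoʳ-≤-nonNeg d {{nonNegative 0≤d}} a≤b)

  *-cancel-nonNeg : ∀ {a} p → 0ℚ < a → 0ℚ ≤ a * p → 0ℚ ≤ p
  *-cancel-nonNeg {a} p 0<a 0≤ap =
    *-cancelˡ-≤-pos a {{positive 0<a}} (subst (_≤ a * p) (sym (*-zeroʳ a)) 0≤ap)

  ^-nonNeg : ∀ {p} k → 0ℚ ≤ p → 0ℚ ≤ p ^ k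
  ^-nonNeg zero    0≤p = <⇒≤ 0<1
  ^-nonNeg (suc k) 0≤p = *-nonNeg 0≤p (^-nonNeg k 0≤p)

  ^-mono-≤ : ∀ {p q} k → 0ℚ ≤ p → p ≤ q → p ^ k ≤ q ^ k
  ^-mono-≤ zero    0≤p p≤q = ≤-refl
  ^-mono-≤ (suc k) 0≤p p≤q =
    *-mono-≤ 0≤p (^-nonNeg k (≤-trans 0≤p p≤q)) p≤q (^-mono-≤ k 0≤p p≤q)

  ^-distribʳ-* : ∀ p q k → (p * q) ^ k ≡ p ^ k * q ^ k
  ^-distribʳ-* p q zero    = refl
  ^-distribʳ-* p q (suc k) = trans (cong (p * q *_) (^-distribʳ-* p q k))
    (solve 4 (λ p q a b → p :* q :* (a :* b) := p :* a :* (q :* b)) refl p q (p ^ k) (q ^ k))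

  ∣p^k∣≡∣p∣^k : ∀ p k → ∣ p ^ k ∣ ≡ ∣ p ∣ ^ k
  ∣p^k∣≡∣p∣^k p zero    = refl
  ∣p^k∣≡∣p∣^k p (suc k) = trans (∣p*q∣≡∣p∣*∣q∣ p (p ^ k)) (cong (∣ p ∣ *_) (∣p^k∣≡∣p∣^k p k))

  p≤∣p∣ : ∀ p → p ≤ ∣ p ∣
  p≤∣p∣ p with 0ℚ ≤? p
  ... | yes 0≤p = ≤-reflexive (sym (0≤p⇒∣p∣≡p 0≤p))
  ... | no  0≰p = ≤-trans (<⇒≤ (≰⇒> 0≰p)) (0≤∣p∣ p)

  ∣p∣≤r : ∀ {p r} → p ≤ r → - p ≤ r → ∣ p ∣ ≤ r
  ∣p∣≤r {p} {r} p≤r -p≤r with ∣p∣≡p∨∣p∣≡-p p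
  ... | inj₁ eq = subst (_≤ r) (sym eq) p≤r
  ... | inj₂ eq = subst (_≤ r) (sym eq) -p≤r

  recip-inverseʳ : ∀ {p} → 0ℚ < p → p * recip p ≡ 1ℚ
  recip-inverseʳ {p@(mkℚ +[1+ _ ] _ _)} 0<p = *-inverseʳ p
  recip-inverseʳ {mkℚ +0 _ _}           0<p with () ← positive 0<p
  recip-inverseʳ {mkℚ -[1+ _ ] _ _}     0<p with () ← positive 0<p

  recip-pos : ∀ {p} → 0ℚ < p → 0ℚ < recip p
  recip-pos {p@(mkℚ +[1+ _ ] _ _)} 0<p = positive⁻¹ (1/ p) {{1/pos⇒pos p}}
  recip-pos {mkℚ +0 _ _}           0<p with () ← positive 0<p
  recip-pos {mkℚ -[1+ _ ] _ _}     0<p with () ← positive 0<p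

  *-recip-cancelˡ : ∀ {a} p → 0ℚ < a → a * (recip a * p) ≡ p
  *-recip-cancelˡ {a} p 0<a = trans (sym (*-assoc a (recip a) p))
    (trans (cong (_* p) (recip-inverseʳ 0<a)) (*-identityˡ p))

  recip-unique : ∀ {a} b → 0ℚ < a → a * b ≡ 1ℚ → b ≡ recip a
  recip-unique {a} b 0<a ab≡1 = begin
    b                     ≡⟨ *-recip-cancelˡ b 0<a ⟨
    a * (recip a * b)     ≡⟨ solve 3 (λ a r b → a :* (r :* b) := r :* (a :* b)) refl a (recip a) b ⟩
    recip a * (a * b)     ≡⟨ cong (recip a *_) ab≡1 ⟩
    recip a * 1ℚ          ≡⟨ *-identityʳ (recip a) ⟩
    recip a               ∎
    where open ≡-Reasoning

  recip-* : ∀ {a b} → 0ℚ < a → 0ℚ < b → recip (a * b) ≡ recip a * recip b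
  recip-* {a} {b} 0<a 0<b = sym (recip-unique (recip a * recip b) (*-pos 0<a 0<b) (begin
    a * b * (recip a * recip b)    ≡⟨ solve 4 (λ a b r s → a :* b :* (r :* s) := a :* r :* (b :* s)) refl a b (recip a) (recip b) ⟩
    a * recip a * (b * recip b)    ≡⟨ cong₂ _*_ (recip-inverseʳ 0<a) (recip-inverseʳ 0<b) ⟩
    1ℚ                             ∎))
    where open ≡-Reasoning

  -- A Lipschitz estimate for powers near [0, 1] whose constant depends on `k` alone. Expanding
  -- `(p + ε) * (p ^ k + ε * L)` and bounding `p ^ k`, `p` and `ε` by 1 gives the recursion from L
  -- to 1 + 2L.
  [p+ε]^k≤p^k+ε*L : ∀ k → ∃[ L ] (0ℚ ≤ L × (∀ {p ε} → 0ℚ ≤ p → p ≤ 1ℚ → 0ℚ ≤ ε → ε ≤ 1ℚ →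
                     (p + ε) ^ k ≤ p ^ k + ε * L))
  [p+ε]^k≤p^k+ε*L zero    = 0ℚ , ≤-refl , λ {p} {ε} _ _ _ _ → ≤-reflexive (sym (cong (1ℚ +_) (*-zeroʳ ε)))
  [p+ε]^k≤p^k+ε*L (suc k) with L , 0≤L , bound ← [p+ε]^k≤p^k+ε*L k =
    1ℚ + (L + L) , +-nonNeg (<⇒≤ 0<1) (+-nonNeg 0≤L 0≤L) , λ {p} {ε} 0≤p p≤1 0≤ε ε≤1 → begin
      (p + ε) * (p + ε) ^ k
        ≤⟨ *-monoˡ-≤-nonNeg (p + ε) {{nonNegative (+-nonNeg 0≤p 0≤ε)}} (bound 0≤p p≤1 0≤ε ε≤1) ⟩
      (p + ε) * (p ^ k + ε * L)
        ≡⟨ solve 4 (λ p ε a L → (p :+ ε) :* (a :+ ε :* L) := p :* a :+ ε :* (a :+ (p :* L :+ ε :* L))) refl p ε (p ^ k) L ⟩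
      p * p ^ k + ε * (p ^ k + (p * L + ε * L))
        ≤⟨ +-monoʳ-≤ (p * p ^ k) (*-monoˡ-≤-nonNeg ε {{nonNegative 0≤ε}}
             (+-mono-≤ (p^k≤1 k 0≤p p≤1) (+-mono-≤ (x*L≤L p≤1 0≤L) (x*L≤L ε≤1 0≤L)))) ⟩
      p * p ^ k + ε * (1ℚ + (L + L)) ∎
    where
    open ≤-Reasoning
    x*L≤L : ∀ {x L} → x ≤ 1ℚ → 0ℚ ≤ L → x * L ≤ L
    x*L≤L {x} {L} x≤1 0≤L = subst (x * L ≤_) (*-identityˡ L) (*-monoʳ-≤-nonNeg L {{nonNegative 0≤L}} x≤1)
    1^k≡1 : ∀ k → 1ℚ ^ k ≡ 1ℚ
    1^k≡1 zero    = refl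
    1^k≡1 (suc k) = trans (*-identityˡ (1ℚ ^ k)) (1^k≡1 k)
    p^k≤1 : ∀ {p} k → 0ℚ ≤ p → p ≤ 1ℚ → p ^ k ≤ 1ℚ
    p^k≤1 {p} k 0≤p p≤1 = subst (p ^ k ≤_) (1^k≡1 k) (^-mono-≤ k 0≤p p≤1)

  ≤⇒0≤- : ∀ {p q} → p ≤ q → 0ℚ ≤ q - p
  ≤⇒0≤- {p} {q} p≤q = subst (_≤ q - p) (+-inverseʳ p) (+-monoˡ-≤ (- p) p≤q)

  0≤-⇒≤ : ∀ {p q} → 0ℚ ≤ q - p → p ≤ q
  0≤-⇒≤ {p} {q} 0≤q-p = subst₂ _≤_ (+-identityˡ p)
    (solve 2 (λ p q → q :- p :+ p := q) refl p q) (+-monoˡ-≤ p 0≤q-p)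

  -- Since 1 − (1−2t)/(1−t) = t/(1−t), in terms of the odds s = t/(1−t) the tree
  -- equation reads s = q (1−s)ᵈ.
  OddsSeparation : ℕ → Set
  OddsSeparation d = ∃[ L ] (0ℚ ≤ L × (∀ {q b η ε y s} →
    0ℚ ≤ q → q ≤ b → 0ℚ ≤ ε → ε ≤ 1ℚ → ε * (1ℚ + b * L) < η →
    0ℚ ≤ y → 0ℚ ≤ 1ℚ - y → η + η ≤ y - q * (1ℚ - y) ^ d →
    - ε ≤ 1ℚ - s → s - q * (1ℚ - s) ^ d ≤ η → s + ε ≤ y))

  -- The function s - q (1 - s)ᵈ increases in s, so a gap in its values forces a gap in the
  -- arguments. If y < s + ε, the Lipschitz estimate bounds its value at y by its value at s plus ε
  -- (1 + b L), hence by less than 2η. The constant `L` depends on `d` alone.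
  odds-separation : ∀ d → OddsSeparation d
  odds-separation d with L , 0≤L , bound ← [p+ε]^k≤p^k+ε*L d = L , 0≤L , λ {q} {b} {η} {ε} {y} {s} → sep {q} {b} {η} {ε} {y} {s}
    where
    open ≤-Reasoning
    sep : ∀ {q b η ε y s} →
      0ℚ ≤ q → q ≤ b → 0ℚ ≤ ε → ε ≤ 1ℚ → ε * (1ℚ + b * L) < η →
      0ℚ ≤ y → 0ℚ ≤ 1ℚ - y → η + η ≤ y - q * (1ℚ - y) ^ d →
      - ε ≤ 1ℚ - s → s - q * (1ℚ - s) ^ d ≤ η → s + ε ≤ y
    sep {q} {b} {η} {ε} {y} {s} 0≤q q≤b 0≤ε ε≤1 small 0≤y 0≤p y-gap -ε≤r s-gap = ≮⇒≥ λ y<s+ε →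
      <-irrefl refl (begin-strict
        η + η
          ≤⟨ y-gap ⟩
        y - q * p ^ d
          ≤⟨ +-mono-≤ (<⇒≤ y<s+ε) (neg-antimono-≤ (*-monoˡ-≤-nonNeg q {{nonNegative 0≤q}} (power y<s+ε))) ⟩
        s + ε - q * (r ^ d - ε * L)
          ≡⟨ solve 5 (λ s ε z rᵈ L → s :+ ε :- z :* (rᵈ :- ε :* L) := (s :- z :* rᵈ) :+ ε :* (con 1ℚ :+ z :* L)) refl s ε q (r ^ d) L ⟩
        s - q * r ^ d + ε * (1ℚ + q * L)
          ≤⟨ +-mono-≤ s-gap (*-monoˡ-≤-nonNeg ε {{nonNegative 0≤ε}}
               (+-monoʳ-≤ 1ℚ (*-monoʳ-≤-nonNeg L {{nonNegative 0≤L}} q≤b))) ⟩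
        η + ε * (1ℚ + b * L)
          <⟨ +-monoʳ-< η small ⟩
        η + η ∎)
      where
      p r : ℚ
      p = 1ℚ - y
      r = 1ℚ - s
      p≤1 : p ≤ 1ℚ
      p≤1 = 0≤-⇒≤ (subst (0ℚ ≤_) (solve 1 (λ y → y := con 1ℚ :- (con 1ℚ :- y)) refl y) 0≤y)
      -- `r` may be slightly negative, where powers are not monotone, so the comparison of `r ^ d`
      -- with `p ^ d` goes through absolute values.
      ∣r∣≤ : y < s + ε → ∣ r ∣ ≤ p + ε
      ∣r∣≤ y<s+ε = ∣p∣≤r
        (0≤-⇒≤ (subst (0ℚ ≤_) (solve 3 (λ s ε y → s :+ ε :- y := con 1ℚ :- y :+ ε :- (con 1ℚ :- s)) refl s ε y)
          (≤⇒0≤- (<⇒≤ y<s+ε))))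
        (begin
          - r            ≤⟨ neg-antimono-≤ -ε≤r ⟩
          - (- ε)      ≡⟨ solve 1 (λ ε → :- (:- ε) := con 0ℚ :+ ε) refl ε ⟩
          0ℚ + ε           ≤⟨ +-monoˡ-≤ ε 0≤p ⟩
          p + ε            ∎)
      power : y < s + ε → r ^ d - ε * L ≤ p ^ d
      power y<s+ε = begin
        r ^ d - ε * L              ≤⟨ +-monoˡ-≤ (- (ε * L)) r^d≤ ⟩
        p ^ d + ε * L - ε * L      ≡⟨ solve 2 (λ a e → a :+ e :- e := a) refl (p ^ d) (ε * L) ⟩
        p ^ d                      ∎
        where
        r^d≤ : r ^ d ≤ p ^ d + ε * L
        r^d≤ = begin
          r ^ d              ≤⟨ p≤∣p∣ (r ^ d) ⟩
          ∣ r ^ d ∣          ≡⟨ ∣p^k∣≡∣p∣^k r d ⟩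
          ∣ r ∣ ^ d          ≤⟨ ^-mono-≤ d (0≤∣p∣ r) (∣r∣≤ y<s+ε) ⟩
          (p + ε) ^ d        ≤⟨ bound 0≤p p≤1 0≤ε ε≤1 ⟩
          p ^ d + ε * L      ∎

  ¼ ⅛ : ℚ
  ¼ = ℤ.+ 1 / 4
  ⅛ = ℤ.+ 1 / 8

  module _ {t : ℚ} (0<ℓ : 0ℚ < 1ℚ - t) where

    1-odds : (1ℚ - ℤ.+ 2 / 1 * t) * recip (1ℚ - t) ≡ 1ℚ - t * recip (1ℚ - t)
    1-odds = trans
      (solve 2 (λ t ρ → (con 1ℚ :- con (ℤ.+ 2 / 1) :* t) :* ρ := (con 1ℚ :- t) :* ρ :- t :* ρ) refl t (recip (1ℚ - t)))
      (cong (_- t * recip (1ℚ - t)) (recip-inverseʳ 0<ℓ))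

    -- Multiplying the tree equation by q turns its left side into the odds s. The error grows by
    -- the factor q, at most b, which is why the tolerance is η / b.
    odds-equation : ∀ d {q b η} → 0ℚ < q → q ≤ b → 0ℚ < b → 0ℚ < η →
      ∣ t * recip (q * (1ℚ - t)) - ((1ℚ - ℤ.+ 2 / 1 * t) * recip (1ℚ - t)) ^ d ∣ < recip b * η →
      t * recip (1ℚ - t) - q * (1ℚ - t * recip (1ℚ - t)) ^ d ≤ η
    odds-equation d {q} {b} {η} 0<q q≤b 0<b 0<η close = begin
      s - q * (1ℚ - s) ^ d
        ≡⟨ cong₂ (λ a w → a - q * w ^ d) q*lhs≡s 1-odds ⟨
      q * lhs - q * rhs
        ≡⟨ solve 3 (λ q l r → q :* l :- q :* r := q :* (l :- r)) refl q lhs rhs ⟩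
      q * (lhs - rhs)
        ≤⟨ *-monoˡ-≤-nonNeg q {{nonNegative (<⇒≤ 0<q)}} (≤-trans (p≤∣p∣ (lhs - rhs)) (<⇒≤ close)) ⟩
      q * (recip b * η)
        ≤⟨ *-monoʳ-≤-nonNeg (recip b * η) {{nonNegative (<⇒≤ (*-pos (recip-pos 0<b) 0<η))}} q≤b ⟩
      b * (recip b * η)
        ≡⟨ *-recip-cancelˡ η 0<b ⟩
      η ∎
      where
      open ≤-Reasoning
      ℓ s lhs rhs : ℚ
      ℓ = 1ℚ - t
      s = t * recip ℓ
      lhs = t * recip (q * ℓ)
      rhs = ((1ℚ - ℤ.+ 2 / 1 * t) * recip ℓ) ^ d
      q*lhs≡s : q * lhs ≡ s
      q*lhs≡s = trans (cong (λ r → q * (t * r)) (recip-* 0<q 0<ℓ)) (trans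
        (solve 4 (λ q t r ρ → q :* (t :* (r :* ρ)) := q :* (r :* (t :* ρ))) refl q t (recip q) (recip ℓ))
        (*-recip-cancelˡ s 0<q))

  -- Passes from odds back to probabilities, since A / Y is the odds of A / (Y + A). Clearing
  -- denominators turns the gap ε into (1 - t) Y ε; with 1 - t at least ¼ and A at most Y this is at
  -- least ⅛ (Y + A) ε.
  odds-≤⇒≤ : ∀ {A Y t ε} → 0ℚ < Y → 0ℚ ≤ A → A ≤ Y → ¼ ≤ 1ℚ - t → 0ℚ ≤ ε →
    t * recip (1ℚ - t) + ε ≤ A * recip Y → t + ε * ⅛ ≤ A * recip (Y + A)
  odds-≤⇒≤ {A} {Y} {t} {ε} 0<Y 0≤A A≤Y ¼≤ℓ 0≤ε odds≤ = *-cancelˡ-≤-pos (Y + A) {{positive 0<Y+A}} (begin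
    (Y + A) * (t + ε * ⅛)
      ≡⟨ solve 4 (λ Y A t ε → (Y :+ A) :* (t :+ ε :* con ⅛) := t :* (Y :+ A) :+ (con ⅛ :* (Y :+ A)) :* ε) refl Y A t ε ⟩
    t * (Y + A) + ⅛ * (Y + A) * ε
      ≤⟨ +-monoʳ-≤ (t * (Y + A)) (*-monoʳ-≤-nonNeg ε {{nonNegative 0≤ε}} (begin
           ⅛ * (Y + A)      ≤⟨ *-monoˡ-≤-nonNeg ⅛ (+-monoʳ-≤ Y A≤Y) ⟩
           ⅛ * (Y + Y)      ≡⟨ solve 1 (λ Y → con ⅛ :* (Y :+ Y) := con ¼ :* Y) refl Y ⟩
           ¼ * Y            ≤⟨ *-monoʳ-≤-nonNeg Y {{nonNegative (<⇒≤ 0<Y)}} ¼≤ℓ ⟩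
           ℓ * Y            ∎)) ⟩
    t * (Y + A) + ℓ * Y * ε
      ≡⟨ cong (λ u → u + ℓ * Y * ε) (solve 3 (λ Y A t → t :* (Y :+ A) := t :* con 1ℚ :* Y :+ t :* A) refl Y A t) ⟩
    t * 1ℚ * Y + t * A + ℓ * Y * ε
      ≡⟨ cong (λ u → t * u * Y + t * A + ℓ * Y * ε) (recip-inverseʳ 0<ℓ) ⟨
    t * (ℓ * ρ) * Y + t * A + ℓ * Y * ε
      ≡⟨ solve 6 (λ t ℓ ρ Y A ε → t :* (ℓ :* ρ) :* Y :+ t :* A :+ ℓ :* Y :* ε := ℓ :* Y :* (t :* ρ :+ ε) :+ t :* A) refl t ℓ ρ Y A ε ⟩
    ℓ * Y * (t * ρ + ε) + t * A
      ≤⟨ +-monoˡ-≤ (t * A) (*-monoˡ-≤-nonNeg (ℓ * Y) {{nonNegative (<⇒≤ (*-pos 0<ℓ 0<Y))}} odds≤) ⟩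
    ℓ * Y * (A * recip Y) + t * A
      ≡⟨ solve 5 (λ t Y A ℓ r → ℓ :* Y :* (A :* r) :+ t :* A := ℓ :* A :* (Y :* r) :+ t :* A) refl t Y A ℓ (recip Y) ⟩
    ℓ * A * (Y * recip Y) + t * A
      ≡⟨ cong (λ u → ℓ * A * u + t * A) (recip-inverseʳ 0<Y) ⟩
    (1ℚ - t) * A * 1ℚ + t * A
      ≡⟨ solve 2 (λ A t → (con 1ℚ :- t) :* A :* con 1ℚ :+ t :* A := A :* con 1ℚ) refl A t ⟩
    A * 1ℚ
      ≡⟨ cong (A *_) (recip-inverseʳ 0<Y+A) ⟨
    A * ((Y + A) * recip (Y + A))
      ≡⟨ solve 3 (λ A P r → A :* (P :* r) := P :* (A :* r)) refl A (Y + A) (recip (Y + A)) ⟩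
    (Y + A) * (A * recip (Y + A)) ∎)
    where
    open ≤-Reasoning
    ℓ ρ : ℚ
    ℓ = 1ℚ - t
    ρ = recip ℓ
    0<ℓ : 0ℚ < ℓ
    0<ℓ = <-≤-trans (positive⁻¹ ¼) ¼≤ℓ
    0<Y+A : 0ℚ < Y + A
    0<Y+A = <-≤-trans 0<Y (p≤p+q Y 0≤A)

-- Finite sums over subsets.

module PartitionFunctions where

  open import Data.Fin.Subset
  open import Data.Fin.Subset.Induction using (⊂-wellFounded; Acc; acc)
  open import Data.Fin.Subset.Properties
  open import Data.Rational.Base using (ℚ; 0ℚ; 1ℚ; _+_; _*_; _≤_; nonNegative)
  open import Data.Vec.Base using (_∷_; [])
  open import Defs using (Graph; allSubsets)
  open Rationals

  ∑ : ∀ {A : Set} → List A → (A → ℚ) → ℚ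
  ∑ []       f = 0ℚ
  ∑ (x ∷ xs) f = f x + ∑ xs f

  module _ {A : Set} where

    ∑-cong : ∀ (xs : List A) {f g} → (∀ x → f x ≡ g x) → ∑ xs f ≡ ∑ xs g
    ∑-cong []       f≗g = refl
    ∑-cong (x ∷ xs) f≗g = cong₂ _+_ (f≗g x) (∑-cong xs f≗g)

    ∑-++ : ∀ (xs ys : List A) f → ∑ (xs ++ ys) f ≡ ∑ xs f + ∑ ys f
    ∑-++ []       ys f = sym (ℚ.+-identityˡ (∑ ys f))
    ∑-++ (x ∷ xs) ys f = trans (cong (f x +_) (∑-++ xs ys f)) (sym (ℚ.+-assoc (f x) (∑ xs f) (∑ ys f)))

    ∑-map : ∀ {B : Set} (h : B → A) xs f → ∑ (map h xs) f ≡ ∑ xs (f ∘ h)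
    ∑-map h []       f = refl
    ∑-map h (x ∷ xs) f = cong (f (h x) +_) (∑-map h xs f)

    ∑-distrib-+ : ∀ (xs : List A) f g → ∑ xs (λ x → f x + g x) ≡ ∑ xs f + ∑ xs g
    ∑-distrib-+ []       f g = refl
    ∑-distrib-+ (x ∷ xs) f g = trans (cong (f x + g x +_) (∑-distrib-+ xs f g))
      (solve 4 (λ a b c d → a :+ b :+ (c :+ d) := a :+ c :+ (b :+ d)) refl (f x) (g x) (∑ xs f) (∑ xs g))

    *-distribˡ-∑ : ∀ c (xs : List A) f → ∑ xs (λ x → c * f x) ≡ c * ∑ xs f
    *-distribˡ-∑ c []       f = sym (ℚ.*-zeroʳ c)
    *-distribˡ-∑ c (x ∷ xs) f =
      trans (cong (c * f x +_) (*-distribˡ-∑ c xs f)) (sym (ℚ.*-distribˡ-+ c (f x) (∑ xs f)))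

    ∑-zero : ∀ (xs : List A) → ∑ xs (λ _ → 0ℚ) ≡ 0ℚ
    ∑-zero []       = refl
    ∑-zero (x ∷ xs) = trans (ℚ.+-identityˡ _) (∑-zero xs)

    ∑-filter : ∀ {P : Pred A 0ℓ} (P? : Decidable P) xs f →
               ∑ (filter P? xs) f ≡ ∑ xs (λ x → if does (P? x) then f x else 0ℚ)
    ∑-filter P? []       f = refl
    ∑-filter P? (x ∷ xs) f with does (P? x)
    ... | true  = cong (f x +_) (∑-filter P? xs f)
    ... | false = trans (∑-filter P? xs f) (sym (ℚ.+-identityˡ _))

  ∑-allSubsets-suc : ∀ {n} (f : Subset (suc n) → ℚ) → ∑ (allSubsets (suc n)) f ≡
    ∑ (allSubsets n) (f ∘ (inside ∷_)) + ∑ (allSubsets n) (f ∘ (outside ∷_))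
  ∑-allSubsets-suc {n} f = trans (∑-++ (map (inside ∷_) (allSubsets n)) _ f)
    (cong₂ _+_ (∑-map (inside ∷_) (allSubsets n) f) (∑-map (outside ∷_) (allSubsets n) f))

  -- Pairs each set avoiding `x` with the same set with `x` added. Sets containing `x` stay in the
  -- index range with value 0, so both sides run over the same list.
  ∑-split : ∀ {n} (x : Fin n) (f : Subset n → ℚ) → ∑ (allSubsets n) f ≡
    ∑ (allSubsets n) (λ I → if lookup I x then 0ℚ else f I + f (I [ x ]≔ inside))
  ∑-split {suc n} zero f = begin
    ∑ (allSubsets (suc n)) f
      ≡⟨ ∑-allSubsets-suc f ⟩
    ∑ (allSubsets n) (f ∘ (inside ∷_)) + ∑ (allSubsets n) (f ∘ (outside ∷_))
      ≡⟨ ℚ.+-comm (∑ (allSubsets n) (f ∘ (inside ∷_))) _ ⟩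
    ∑ (allSubsets n) (f ∘ (outside ∷_)) + ∑ (allSubsets n) (f ∘ (inside ∷_))
      ≡⟨ ∑-distrib-+ (allSubsets n) _ _ ⟨
    ∑ (allSubsets n) (λ I → f (outside ∷ I) + f (inside ∷ I))
      ≡⟨ ℚ.+-identityˡ _ ⟨
    0ℚ + ∑ (allSubsets n) (λ I → f (outside ∷ I) + f (inside ∷ I))
      ≡⟨ cong (_+ ∑ (allSubsets n) (λ I → f (outside ∷ I) + f (inside ∷ I))) (∑-zero (allSubsets n)) ⟨
    ∑ (allSubsets n) (λ _ → 0ℚ) + ∑ (allSubsets n) (λ I → f (outside ∷ I) + f (inside ∷ I))
      ≡⟨ ∑-allSubsets-suc (λ I → if lookup I zero then 0ℚ else f I + f (I [ zero ]≔ inside)) ⟨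
    ∑ (allSubsets (suc n)) (λ I → if lookup I zero then 0ℚ else f I + f (I [ zero ]≔ inside)) ∎
    where open ≡-Reasoning
  ∑-split {suc n} (suc x) f = trans (∑-allSubsets-suc f)
    (trans (cong₂ _+_ (∑-split x (f ∘ (inside ∷_))) (∑-split x (f ∘ (outside ∷_))))
           (sym (∑-allSubsets-suc (λ I → if lookup I (suc x) then 0ℚ else f I + f (I [ suc x ]≔ inside)))))

  ∑-only-⊥ : ∀ {n} (f : Subset n → ℚ) → (∀ I → Nonempty I → f I ≡ 0ℚ) → ∑ (allSubsets n) f ≡ f ⊥
  ∑-only-⊥ {zero}  f f≡0 = ℚ.+-identityʳ (f [])
  ∑-only-⊥ {suc n} f f≡0 = begin
    ∑ (allSubsets (suc n)) f
      ≡⟨ ∑-allSubsets-suc f ⟩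
    ∑ (allSubsets n) (f ∘ (inside ∷_)) + ∑ (allSubsets n) (f ∘ (outside ∷_))
      ≡⟨ cong₂ _+_ (trans (∑-cong (allSubsets n) λ I → f≡0 (inside ∷ I) (zero , Vec.here)) (∑-zero (allSubsets n)))
                   (∑-only-⊥ (f ∘ (outside ∷_)) λ { I (x , x∈I) → f≡0 (outside ∷ I) (suc x , Vec.there x∈I) }) ⟩
    0ℚ + f ⊥
      ≡⟨ ℚ.+-identityˡ (f ⊥) ⟩
    f ⊥ ∎
    where open ≡-Reasoning

  σ-injective : ∀ {n} (σ : Permutation′ n) {a b} → σ ⟨$⟩ʳ a ≡ σ ⟨$⟩ʳ b → a ≡ b
  σ-injective σ eq = trans (sym (inverseˡ σ)) (trans (cong (σ ⟨$⟩ˡ_) eq) (inverseˡ σ))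

  x∈p─q⇒x∉q : ∀ {n x} (p q : Subset n) → x ∈ p ─ q → x ∉ q
  x∈p─q⇒x∉q (_ ∷ p) (outside ∷ q) (Vec.there x∈) (Vec.there x∈q) = x∈p─q⇒x∉q p q x∈ x∈q
  x∈p─q⇒x∉q (_ ∷ p) (inside ∷ q)  (Vec.there x∈) (Vec.there x∈q) = x∈p─q⇒x∉q p q x∈ x∈q

  x∉p-x : ∀ {n x} (p : Subset n) → x ∉ p - x
  x∉p-x {x = x} p x∈ = x∈p─q⇒x∉q p ⁅ x ⁆ x∈ (x∈⁅x⁆ x)

  p-x⊆p : ∀ {n} (p : Subset n) x → p - x ⊆ p
  p-x⊆p p x = p─q⊆p p ⁅ x ⁆

  x∉p⇒p-x≡p : ∀ {n x} {p : Subset n} → x ∉ p → p - x ≡ p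
  x∉p⇒p-x≡p {x = x} {p} x∉p = ⊆-antisym (p-x⊆p p x) λ y∈p → x∈p∧x≢y⇒x∈p-y y∈p λ { refl → x∉p y∈p }

  ∣p[x]≔inside∣ : ∀ {n} (p : Subset n) x → lookup p x ≡ outside → ∣ p [ x ]≔ inside ∣ ≡ suc ∣ p ∣
  ∣p[x]≔inside∣ (outside ∷ p) zero    _  = refl
  ∣p[x]≔inside∣ (outside ∷ p) (suc x) x∉ = ∣p[x]≔inside∣ p x x∉
  ∣p[x]≔inside∣ (inside ∷ p)  (suc x) x∉ = cong suc (∣p[x]≔inside∣ p x x∉)

  p⊆p[x]≔inside : ∀ {n} (p : Subset n) x → p ⊆ p [ x ]≔ inside
  p⊆p[x]≔inside p x {y} y∈p with y ≟ x
  ... | yes refl = []≔-updates p x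
  ... | no  y≢x  = []≔-minimal p y x y≢x y∈p

  x∈p[y]≔inside⁻ : ∀ {n x y} (p : Subset n) → x ∈ p [ y ]≔ inside → x ≢ y → x ∈ p
  x∈p[y]≔inside⁻ {x = x} {y} p x∈ x≢y = lookup⇒[]= x p
    (trans (sym (lookup∘update′ x≢y p inside)) ([]=⇒lookup x∈))

  -- Partition functions of induced subgraphs.

  module PartitionFunction {n : ℕ} (G : Graph n) (q : ℚ) where
    open Graph G

    Admissible : Subset n → Subset n → Set
    Admissible S I = Independent I × I ⊆ S

    admissible? : ∀ S → Decidable (Admissible S)
    admissible? S I = independent? I ×-dec I ⊆? S

    term : Subset n → Subset n → ℚ
    term S I = if does (admissible? S I) then q ^ ∣ I ∣ else 0ℚ

    -- The partition function of the subgraph induced on S.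
    Z : Subset n → ℚ
    Z S = ∑ (allSubsets n) (term S)

    term-cong : ∀ S T I → Admissible S I ⇔ Admissible T I → term S I ≡ term T I
    term-cong S T I S⇔T =
      cong (if_then q ^ ∣ I ∣ else 0ℚ) (does-⇔ S⇔T (admissible? S I) (admissible? T I))

    term-zero : ∀ S I → ¬ Admissible S I → term S I ≡ 0ℚ
    term-zero S I ¬adm = cong (if_then q ^ ∣ I ∣ else 0ℚ) (dec-false (admissible? S I) ¬adm)

    term-suc : ∀ S T I J → Admissible S J ⇔ Admissible T I → ∣ J ∣ ≡ suc ∣ I ∣ → term S J ≡ q * term T I
    term-suc S T I J S⇔T ∣J∣≡ rewrite does-⇔ S⇔T (admissible? S J) (admissible? T I) | ∣J∣≡
      with does (admissible? T I)
    ... | true  = refl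
    ... | false = sym (ℚ.*-zeroʳ q)

    ∈-neighbours⁺ : ∀ {x y} → x ~ y → y ∈ neighbours x
    ∈-neighbours⁺ {x} {y} x~y = lookup⇒[]= y (neighbours x)
      (trans (lookup∘tabulate _ y) (dec-true (x ~? y) x~y))

    ∈-neighbours⁻ : ∀ {x y} → y ∈ neighbours x → x ~ y
    ∈-neighbours⁻ {x} {y} y∈ with x ~? y | trans (sym (lookup∘tabulate (does ∘ (x ~?_)) y)) ([]=⇒lookup y∈)
    ... | yes x~y | _ = x~y

    -- The deletion recursion: an independent set either avoids `x`, or consists of `x`,
    -- contributing a factor `q`, and an independent set avoiding `x` and its neighbours.
    Z-step : ∀ {S x} → x ∈ S → Z S ≡ Z (S - x) + q * Z (S - x ─ neighbours x)
    Z-step {S} {x} x∈S = begin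
      Z S
        ≡⟨ ∑-split x (term S) ⟩
      ∑ (allSubsets n) (λ I → if lookup I x then 0ℚ else term S I + term S (I [ x ]≔ inside))
        ≡⟨ ∑-cong (allSubsets n) pointwise ⟩
      ∑ (allSubsets n) (λ I → term (S - x) I + q * term (S - x ─ neighbours x) I)
        ≡⟨ ∑-distrib-+ (allSubsets n) _ _ ⟩
      Z (S - x) + ∑ (allSubsets n) (λ I → q * term (S - x ─ neighbours x) I)
        ≡⟨ cong (Z (S - x) +_) (*-distribˡ-∑ q (allSubsets n) (term (S - x ─ neighbours x))) ⟩
      Z (S - x) + q * Z (S - x ─ neighbours x) ∎
      where
      open ≡-Reasoning
      S─N : Subset n
      S─N = S - x ─ neighbours x

      pointwise : ∀ I → (if lookup I x then 0ℚ else term S I + term S (I [ x ]≔ inside))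
                        ≡ term (S - x) I + q * term S─N I
      pointwise I with lookup I x in I[x]
      ... | true = sym (trans
        (cong₂ (λ a b → a + q * b)
          (term-zero (S - x) I λ (_ , I⊆) → x∉p-x S (I⊆ x∈I))
          (term-zero S─N I λ (_ , I⊆) → x∉p-x S (p─q⊆p (S - x) (neighbours x) (I⊆ x∈I))))
        (trans (ℚ.+-identityˡ (q * 0ℚ)) (ℚ.*-zeroʳ q)))
        where
        x∈I : x ∈ I
        x∈I = lookup⇒[]= x I I[x]
      ... | false = cong₂ _+_
        (term-cong S (S - x) I (mk⇔
          (λ (ind , I⊆S) → ind , λ y∈I → x∈p∧x≢y⇒x∈p-y (I⊆S y∈I) λ { refl → x∉I y∈I })
          (λ (ind , I⊆) → ind , p-x⊆p S x ∘ I⊆)))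
        (term-suc S S─N I J (mk⇔ to from) (∣p[x]≔inside∣ I x I[x]))
        where
        J : Subset n
        J = I [ x ]≔ inside
        x∉I : x ∉ I
        x∉I x∈I with () ← trans (sym I[x]) ([]=⇒lookup x∈I)
        to : Admissible S J → Admissible S─N I
        to (ind , J⊆S) =
          (λ u v u∈I v∈I → ind u v (p⊆p[x]≔inside I x u∈I) (p⊆p[x]≔inside I x v∈I)) ,
          λ {y} y∈I → x∈p∧x∉q⇒x∈p─q
            (x∈p∧x≢y⇒x∈p-y (J⊆S (p⊆p[x]≔inside I x y∈I)) λ { refl → x∉I y∈I })
            (λ y∈N → ind x y ([]≔-updates I x) (p⊆p[x]≔inside I x y∈I) (∈-neighbours⁻ y∈N))
        from : Admissible S─N I → Admissible S J
        from (ind , I⊆) = ind′ , J⊆S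
          where
          x≁I : ∀ {y} → y ∈ I → ¬ x ~ y
          x≁I y∈I x~y = x∈p─q⇒x∉q (S - x) (neighbours x) (I⊆ y∈I) (∈-neighbours⁺ x~y)
          ind′ : Independent J
          ind′ u v u∈J v∈J u~v with u ≟ x | v ≟ x
          ... | yes refl | yes refl = irrefl refl u~v
          ... | yes refl | no  v≢x  = x≁I (x∈p[y]≔inside⁻ I v∈J v≢x) u~v
          ... | no  u≢x  | yes refl = x≁I (x∈p[y]≔inside⁻ I u∈J u≢x) (sym-~ u~v)
          ... | no  u≢x  | no  v≢x  = ind u v (x∈p[y]≔inside⁻ I u∈J u≢x) (x∈p[y]≔inside⁻ I v∈J v≢x) u~v
          J⊆S : J ⊆ S
          J⊆S {y} y∈J with y ≟ x
          ... | yes refl = x∈S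
          ... | no  y≢x  = p-x⊆p S x (p─q⊆p (S - x) (neighbours x) (I⊆ (x∈p[y]≔inside⁻ I y∈J y≢x)))

    Z-⊥ : Z ⊥ ≡ 1ℚ
    Z-⊥ = trans
      (∑-only-⊥ (term ⊥) λ I (x , x∈I) → term-zero ⊥ I λ (_ , I⊆⊥) → ∉⊥ (I⊆⊥ x∈I))
      (trans (cong (if_then q ^ ∣ ⊥ {n} ∣ else 0ℚ)
               (dec-true (admissible? ⊥ ⊥) ((λ u v u∈⊥ → contradiction u∈⊥ ∉⊥) , ⊆-refl)))
             (cong (q ^_) (∣⊥∣≡0 n)))

    -- Unfolding `Z-step` on both sides at corresponding vertices keeps the two vertex sets in
    -- correspondence, so the sum over subsets need not be reindexed along `σ`.
    Z-permute : ∀ {σ} → IsAutomorphism σ → ∀ {S T} → (∀ y → y ∈ S ⇔ σ ⟨$⟩ʳ y ∈ T) → Z S ≡ Z T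
    Z-permute {σ} aut {S} = go S (⊂-wellFounded S)
      where
      open Equivalence
      go : ∀ S → Acc _⊂_ S → ∀ {T} → (∀ y → y ∈ S ⇔ σ ⟨$⟩ʳ y ∈ T) → Z S ≡ Z T
      go S (acc rec) {T} S≅T with nonempty? S
      ... | no S-empty = cong Z (trans (Empty-unique S-empty) (sym (Empty-unique T-empty)))
        where
        T-empty : Empty T
        T-empty (y , y∈T) = S-empty (σ ⟨$⟩ˡ y , from (S≅T _) (subst (_∈ T) (sym (inverseʳ σ)) y∈T))
      ... | yes (x , x∈S) = begin
        Z S                                           ≡⟨ Z-step x∈S ⟩
        Z (S - x) + q * Z (S - x ─ neighbours x)      ≡⟨ cong₂ (λ a b → a + q * b) (go (S - x) (rec S-x⊂S) S-x≅) (go (S - x ─ neighbours x) (rec S─N⊂S) S─N≅) ⟩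
        Z (T - y) + q * Z (T - y ─ neighbours y)      ≡⟨ Z-step (to (S≅T x) x∈S) ⟨
        Z T ∎
        where
        open ≡-Reasoning
        y : Fin n
        y = σ ⟨$⟩ʳ x
        S-x⊂S : S - x ⊂ S
        S-x⊂S = x∈p⇒p-x⊂p x∈S
        S─N⊂S : S - x ─ neighbours x ⊂ S
        S─N⊂S = ⊆-⊂-trans (p─q⊆p (S - x) (neighbours x)) S-x⊂S
        S-x≅ : ∀ a → a ∈ S - x ⇔ σ ⟨$⟩ʳ a ∈ T - y
        S-x≅ a = mk⇔
          (λ a∈ → x∈p∧x≢y⇒x∈p-y (to (S≅T a) (p-x⊆p S x a∈)) λ eq → x∉p-x S (subst (_∈ S - x) (σ-injective σ eq) a∈))
          (λ σa∈ → x∈p∧x≢y⇒x∈p-y (from (S≅T a) (p-x⊆p T y σa∈)) λ { refl → x∉p-x T σa∈ })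
        S─N≅ : ∀ a → a ∈ S - x ─ neighbours x ⇔ σ ⟨$⟩ʳ a ∈ T - y ─ neighbours y
        S─N≅ a = mk⇔
          (λ a∈ → x∈p∧x∉q⇒x∈p─q (to (S-x≅ a) (p─q⊆p (S - x) (neighbours x) a∈))
            λ σa∈N → x∈p─q⇒x∉q (S - x) (neighbours x) a∈ (∈-neighbours⁺ (from (aut x a) (∈-neighbours⁻ σa∈N))))
          (λ σa∈ → x∈p∧x∉q⇒x∈p─q (from (S-x≅ a) (p─q⊆p (T - y) (neighbours y) σa∈))
            λ a∈N → x∈p─q⇒x∉q (T - y) (neighbours y) σa∈ (∈-neighbours⁺ (to (aut x a) (∈-neighbours⁻ a∈N))))

    Z-total : ∑ (filter independent? (allSubsets n)) (λ I → q ^ ∣ I ∣) ≡ Z ⊤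
    Z-total = trans (∑-filter independent? (allSubsets n) (λ I → q ^ ∣ I ∣))
      (∑-cong (allSubsets n) λ I → cong (if_then q ^ ∣ I ∣ else 0ℚ)
        (does-⇔ (mk⇔ {B = Admissible ⊤ I} (λ ind → ind , λ _ → ∈⊤) proj₁) (independent? I) (admissible? ⊤ I)))

    -- An independent set that does not contain `v` is one of the graph without `v`. This expresses
    -- the numerator of an occupation probability through `Z`.
    Z-containing : ∀ v → ∑ (filter (v ∈?_) (filter independent? (allSubsets n))) (λ I → q ^ ∣ I ∣) + Z (⊤ - v) ≡ Z ⊤
    Z-containing v = begin
      ∑ (filter (v ∈?_) (filter independent? (allSubsets n))) (λ I → q ^ ∣ I ∣) + Z (⊤ - v)
        ≡⟨ cong (_+ Z (⊤ - v)) (trans (∑-filter (v ∈?_) (filter independent? (allSubsets n)) _)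
                                      (∑-filter independent? (allSubsets n) _)) ⟩
      ∑ (allSubsets n) containing + Z (⊤ - v)
        ≡⟨ ∑-distrib-+ (allSubsets n) containing (term (⊤ - v)) ⟨
      ∑ (allSubsets n) (λ I → containing I + term (⊤ - v) I)
        ≡⟨ ∑-cong (allSubsets n) pointwise ⟩
      Z ⊤ ∎
      where
      open ≡-Reasoning
      containing : Subset n → ℚ
      containing I = if does (independent? I) then (if does (v ∈? I) then q ^ ∣ I ∣ else 0ℚ) else 0ℚ
      combine : ∀ b c {d e} w → d ≡ not c → e ≡ true →
        (if b then (if c then w else 0ℚ) else 0ℚ) + (if b ∧ d then w else 0ℚ) ≡ (if b ∧ e then w else 0ℚ)
      combine false _     w _    _    = refl
      combine true  true  w refl refl = ℚ.+-identityʳ w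
      combine true  false w refl refl = ℚ.+-identityˡ w
      pointwise : ∀ I → containing I + term (⊤ - v) I ≡ term ⊤ I
      pointwise I = combine (does (independent? I)) (does (v ∈? I)) (q ^ ∣ I ∣)
        (does-⇔ (mk⇔ {A = I ⊆ ⊤ - v} {B = v ∉ I} (λ I⊆ v∈I → x∉p-x ⊤ (I⊆ v∈I))
                     λ v∉I y∈I → x∈p∧x≢y⇒x∈p-y ∈⊤ λ { refl → v∉I y∈I })
          (I ⊆? (⊤ - v)) (¬? (v ∈? I)))
        (dec-true (I ⊆? ⊤) ⊆⊤)

    1≤Z : 0ℚ ≤ q → ∀ S → 1ℚ ≤ Z S
    1≤Z 0≤q S = go S (⊂-wellFounded S)
      where
      go : ∀ S → Acc _⊂_ S → 1ℚ ≤ Z S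
      go S (acc rec) with nonempty? S
      ... | no S-empty = ℚ.≤-reflexive (sym (trans (cong Z (Empty-unique S-empty)) Z-⊥))
      ... | yes (x , x∈S) = subst (1ℚ ≤_) (sym (Z-step x∈S)) (ℚ.≤-trans (go (S - x) (rec S-x⊂S))
        (p≤p+q (Z (S - x)) (*-nonNeg 0≤q (ℚ.≤-trans (ℚ.<⇒≤ 0<1)
          (go (S - x ─ neighbours x) (rec (⊆-⊂-trans (p─q⊆p (S - x) (neighbours x)) S-x⊂S)))))))
        where
        S-x⊂S : S - x ⊂ S
        S-x⊂S = x∈p⇒p-x⊂p x∈S

    -- Each vertex contributes at most a factor 1 + b. The bound is uniform in q, which is what
    -- allows factors `Z` to be cancelled from uniform lower bounds.
    Z≤[1+b]^∣S∣ : ∀ {b} → 0ℚ ≤ q → q ≤ b → ∀ S → Z S ≤ (1ℚ + b) ^ ∣ S ∣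
    Z≤[1+b]^∣S∣ {b} 0≤q q≤b S = go S (⊂-wellFounded S)
      where
      0≤b : 0ℚ ≤ b
      0≤b = ℚ.≤-trans 0≤q q≤b
      1≤1+b : 1ℚ ≤ 1ℚ + b
      1≤1+b = p≤p+q 1ℚ 0≤b
      ^-mono-exponent : ∀ {k l} → k ℕ.≤ l → (1ℚ + b) ^ k ≤ (1ℚ + b) ^ l
      ^-mono-exponent {l = l} ℕ.z≤n = go′ l
        where
        go′ : ∀ l → 1ℚ ≤ (1ℚ + b) ^ l
        go′ zero    = ℚ.≤-refl
        go′ (suc l) = *-mono-≤ (ℚ.<⇒≤ 0<1) (ℚ.≤-trans (ℚ.<⇒≤ 0<1) (go′ l)) 1≤1+b (go′ l)
      ^-mono-exponent (ℕ.s≤s k≤l) = ℚ.*-monoˡ-≤-nonNeg (1ℚ + b)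
        {{nonNegative (ℚ.≤-trans (ℚ.<⇒≤ 0<1) 1≤1+b)}} (^-mono-exponent k≤l)
      go : ∀ S → Acc _⊂_ S → Z S ≤ (1ℚ + b) ^ ∣ S ∣
      go S (acc rec) with nonempty? S
      ... | no S-empty = ℚ.≤-trans (ℚ.≤-reflexive (trans (cong Z (Empty-unique S-empty)) Z-⊥))
                                   (^-mono-exponent {0} {∣ S ∣} ℕ.z≤n)
      ... | yes (x , x∈S) = begin
        Z S
          ≡⟨ Z-step x∈S ⟩
        Z (S - x) + q * Z S─N
          ≤⟨ ℚ.+-mono-≤ (go (S - x) (rec S-x⊂S))
               (*-mono-≤ 0≤q (^-nonNeg ∣ S - x ∣ (ℚ.≤-trans (ℚ.<⇒≤ 0<1) 1≤1+b)) q≤b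
                 (ℚ.≤-trans (go S─N (rec (⊆-⊂-trans S─N⊆ S-x⊂S))) (^-mono-exponent (p⊆q⇒∣p∣≤∣q∣ S─N⊆)))) ⟩
        m + b * m
          ≡⟨ solve 2 (λ b m → m :+ b :* m := (con 1ℚ :+ b) :* m) refl b m ⟩
        (1ℚ + b) ^ suc ∣ S - x ∣
          ≤⟨ ^-mono-exponent (x∈p⇒∣p-x∣<∣p∣ x∈S) ⟩
        (1ℚ + b) ^ ∣ S ∣ ∎
        where
        open ℚ.≤-Reasoning
        S─N : Subset n
        S─N = S - x ─ neighbours x
        m : ℚ
        m = (1ℚ + b) ^ ∣ S - x ∣
        S─N⊆ : S─N ⊆ S - x
        S─N⊆ = p─q⊆p (S - x) (neighbours x)
        S-x⊂S : S - x ⊂ S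
        S-x⊂S = x∈p⇒p-x⊂p x∈S

-- Correlations in bipartite graphs.

module Correlations where

  open import Data.Fin.Subset
  open import Data.Fin.Subset.Induction using (⊂-wellFounded; Acc; acc)
  open import Data.Fin.Subset.Properties
  open import Data.Rational.Base
    using (ℚ; 0ℚ; 1ℚ; _+_; _*_; _<_; _≤_; positive; nonNegative) renaming (_-_ to _−_;
      -_ to neg_)
  open import Defs using (Graph; recip)
  open Rationals
  open PartitionFunctions

  module _ {n : ℕ} where

    infixl 5 _∖∖_

    -- Vertices are removed one at a time, the head of the list last, so that telescoping sums can
    -- follow the structure of the list.
    _∖∖_ : Subset n → List (Fin n) → Subset n
    S ∖∖ xs = foldr (λ x T → T - x) S xs

    ∖∖-⊆ : ∀ S xs → S ∖∖ xs ⊆ S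
    ∖∖-⊆ S []       = id
    ∖∖-⊆ S (x ∷ xs) = ∖∖-⊆ S xs ∘ p-x⊆p (S ∖∖ xs) x

    ∈-∖∖⁺ : ∀ {S y} xs → y ∈ S → ¬ y List.∈ xs → y ∈ S ∖∖ xs
    ∈-∖∖⁺ []       y∈S y∉xs = y∈S
    ∈-∖∖⁺ (x ∷ xs) y∈S y∉xs = x∈p∧x≢y⇒x∈p-y (∈-∖∖⁺ xs y∈S (y∉xs ∘ there)) (y∉xs ∘ here)

    ∈-∖∖⁻ : ∀ {S y} xs → y ∈ S ∖∖ xs → ¬ y List.∈ xs
    ∈-∖∖⁻ {S} (x ∷ xs) y∈ (here refl)  = x∉p-x (S ∖∖ xs) y∈
    ∈-∖∖⁻ {S} (x ∷ xs) y∈ (there y∈xs) = ∈-∖∖⁻ xs (p-x⊆p (S ∖∖ xs) x y∈) y∈xs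

  -- Simple paths in induced subgraphs.

  module Connectivity {n : ℕ} (G : Graph n) where
    open Graph G

    neighbourList : Fin n → List (Fin n)
    neighbourList v = filter (v ~?_) (allFin n)

    ∈-neighbourList⁺ : ∀ {v u} → v ~ u → u List.∈ neighbourList v
    ∈-neighbourList⁺ {v} {u} v~u = ∈-filter⁺ (v ~?_) (∈-allFin u) v~u

    ∈-neighbourList⁻ : ∀ {v u} → u List.∈ neighbourList v → v ~ u
    ∈-neighbourList⁻ {v} u∈ = proj₂ (∈-filter⁻ (v ~?_) {xs = allFin n} u∈)

    -- Simple paths inside S: a vertex is removed from S once it has been left.
    data Path (S : Subset n) : Fin n → Fin n → Set where
      stop : ∀ {w} → w ∈ S → Path S w w
      step : ∀ {u x w} → u ∈ S → u ~ x → Path (S - u) x w → Path S u w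

    Path-start : ∀ {S u w} → Path S u w → u ∈ S
    Path-start (stop u∈S)     = u∈S
    Path-start (step u∈S _ _) = u∈S

    Path-⊆ : ∀ {S T u w} → S ⊆ T → Path S u w → Path T u w
    Path-⊆ S⊆T (stop w∈S) = stop (S⊆T w∈S)
    Path-⊆ {S} {T} {u} S⊆T (step u∈S u~x p) = step (S⊆T u∈S) u~x (Path-⊆ S-u⊆T-u p)
      where
      S-u⊆T-u : S - u ⊆ T - u
      S-u⊆T-u y∈ = x∈p∧x≢y⇒x∈p-y (S⊆T (p-x⊆p S u y∈)) λ { refl → x∉p-x S y∈ }

    -- Follow the path until it meets `y`: what remains is a path from `y`. If it never does, `y`
    -- can be deleted from the ambient set.
    shortcut-or-avoid : ∀ {S x w} y → Path S x w → Path S y w ⊎ Path (S - y) x w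
    shortcut-or-avoid {w = w} y (stop w∈S) with w ≟ y
    ... | yes refl = inj₁ (stop w∈S)
    ... | no  w≢y  = inj₂ (stop (x∈p∧x≢y⇒x∈p-y w∈S w≢y))
    shortcut-or-avoid {S} {x} {w} y (step {x = x′} x∈S x~x′ p) with x ≟ y
    ... | yes refl = inj₁ (step x∈S x~x′ p)
    ... | no  x≢y  = Sum.map (Path-⊆ (p-x⊆p S x))
      (λ p′ → step (x∈p∧x≢y⇒x∈p-y x∈S x≢y) x~x′ (subst (λ T → Path T x′ w) (p─x─y≡p─y─x S x y) p′))
      (shortcut-or-avoid y p)

    -- Prepending `y` could break simplicity; if the path already visits `y`, its part from `y`
    -- onwards is taken instead.
    Path-cons : ∀ {S x y w} → y ∈ S → y ~ x → Path S x w → Path S y w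
    Path-cons {y = y} y∈S y~x p = Sum.[ id , step y∈S y~x ] (shortcut-or-avoid y p)

    path? : ∀ S u w → Dec (Path S u w)
    path? S = go S (⊂-wellFounded S)
      where
      go : ∀ S → Acc _⊂_ S → ∀ u w → Dec (Path S u w)
      go S (acc rec) u w with u ∈? S
      ... | no  u∉S = no (u∉S ∘ Path-start)
      ... | yes u∈S with u ≟ w
      ...   | yes refl = yes (stop u∈S)
      ...   | no  u≢w  = map′ (λ (x , u~x , p) → step u∈S u~x p)
        (λ { (stop _) → contradiction refl u≢w ; (step {x = x} _ u~x p) → x , u~x , p })
        (any? λ x → (u ~? x) ×-dec go (S - u) (rec (x∈p⇒p-x⊂p u∈S)) x w)

  -- Lower bounds uniform over a family of parameters.

  module UniformBounds {T : Set} where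

    UniformlyPositive : (T → ℚ) → Set
    UniformlyPositive f = ∃[ ε ] (0ℚ < ε × ∀ τ → ε ≤ f τ)

    UP-≤ : ∀ {f g : T → ℚ} → UniformlyPositive f → (∀ τ → f τ ≤ g τ) → UniformlyPositive g
    UP-≤ (ε , 0<ε , ε≤f) f≤g = ε , 0<ε , λ τ → ℚ.≤-trans (ε≤f τ) (f≤g τ)

    UP-≡ : ∀ {f g : T → ℚ} → (∀ τ → f τ ≡ g τ) → UniformlyPositive f → UniformlyPositive g
    UP-≡ f≗g f₊ = UP-≤ f₊ (λ τ → ℚ.≤-reflexive (f≗g τ))

    UP-+ : ∀ {f g : T → ℚ} → UniformlyPositive f → (∀ τ → 0ℚ ≤ g τ) → UniformlyPositive (λ τ → f τ + g τ)
    UP-+ {f} f₊ 0≤g = UP-≤ f₊ (λ τ → p≤p+q (f τ) (0≤g τ))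

    UP-* : ∀ {f g : T → ℚ} → UniformlyPositive f → UniformlyPositive g → UniformlyPositive (λ τ → f τ * g τ)
    UP-* (ε , 0<ε , ε≤f) (η , 0<η , η≤g) = ε * η , *-pos 0<ε 0<η , λ τ →
      *-mono-≤ (ℚ.<⇒≤ 0<ε) (ℚ.≤-trans (ℚ.<⇒≤ 0<η) (η≤g τ)) (ε≤f τ) (η≤g τ)

    UP-^ : ∀ {f : T → ℚ} k → UniformlyPositive f → UniformlyPositive (λ τ → f τ ^ k)
    UP-^ zero    _  = 1ℚ , 0<1 , λ _ → ℚ.≤-refl
    UP-^ (suc k) f₊ = UP-* f₊ (UP-^ k f₊)

    -- A factor can be cancelled uniformly only if it is bounded above: the lower bound ε becomes ε
    -- / M.
    UP-cancel : ∀ (f : T → ℚ) {g M} → (∀ τ → 0ℚ < f τ) → (∀ τ → f τ ≤ M) → 0ℚ < M →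
                UniformlyPositive (λ τ → f τ * g τ) → UniformlyPositive g
    UP-cancel f {g} {M} 0<f f≤M 0<M (ε , 0<ε , ε≤fg) = recip-M * ε , *-pos (recip-pos 0<M) 0<ε , λ τ →
      ℚ.*-cancelˡ-≤-pos M {{positive 0<M}} (begin
        M * (recip-M * ε)    ≡⟨ *-recip-cancelˡ ε 0<M ⟩
        ε                    ≤⟨ ε≤fg τ ⟩
        f τ * g τ            ≤⟨ ℚ.*-monoʳ-≤-nonNeg (g τ) {{nonNegative (0≤g τ)}} (f≤M τ) ⟩
        M * g τ              ∎)
      where
      open ℚ.≤-Reasoning
      recip-M : ℚ
      recip-M = recip M
      0≤g : ∀ τ → 0ℚ ≤ g τ
      0≤g τ = *-cancel-nonNeg (g τ) (0<f τ) (ℚ.≤-trans (ℚ.<⇒≤ 0<ε) (ε≤fg τ))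

  -- The signed correlation inequality and its strictness along paths.

  module Correlation {n : ℕ} (G : Graph n)
    (side : Fin n → Bool) (bipartite : ∀ u v → Graph._~_ G u v → side u ≢ side v)
    {T : Set} (q : T → ℚ) {δ b : ℚ} (0<δ : 0ℚ < δ) (δ≤q : ∀ τ → δ ≤ q τ) (q≤b : ∀ τ → q τ ≤ b) where

    open Graph G
    open Connectivity G
    open UniformBounds {T}
    module PF (τ : T) = PartitionFunction G (q τ)
    open PF using (Z; Z-step; ∈-neighbours⁺; ∈-neighbours⁻) public

    0<q : ∀ τ → 0ℚ < q τ
    0<q τ = ℚ.<-≤-trans 0<δ (δ≤q τ)

    0≤q : ∀ τ → 0ℚ ≤ q τ
    0≤q τ = ℚ.<⇒≤ (0<q τ)

    q-UP : UniformlyPositive q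
    q-UP = δ , 0<δ , δ≤q

    Z-UP : ∀ S → UniformlyPositive (λ τ → Z τ S)
    Z-UP S = 1ℚ , 0<1 , λ τ → PF.1≤Z τ (0≤q τ) S

    0<Z : ∀ τ S → 0ℚ < Z τ S
    0<Z τ S = ℚ.<-≤-trans 0<1 (PF.1≤Z τ (0≤q τ) S)

    0≤Z : ∀ τ S → 0ℚ ≤ Z τ S
    0≤Z τ S = ℚ.<⇒≤ (0<Z τ S)

    Z-cancel : ∀ S {g} → UniformlyPositive (λ τ → Z τ S * g τ) → UniformlyPositive g
    Z-cancel S {g} (ε , 0<ε , ε≤) = UP-cancel (λ τ → Z τ S) {M = 1ℚ + M} (λ τ → 0<Z τ S)
      (λ τ → ℚ.≤-trans (PF.Z≤[1+b]^∣S∣ τ (0≤q τ) (ℚ.≤-trans (q≤b τ) b≤b⊔0) S) M≤1+M)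
      (ℚ.<-≤-trans 0<1 (p≤p+q 1ℚ 0≤M)) (ε , 0<ε , ε≤)
      where
      -- `T` may be empty, so `b` is not known to be nonnegative; the maximum with 0 keeps the bound
      -- nonnegative in every case.
      b⁺ M : ℚ
      b⁺ = b ℚ.⊔ 0ℚ
      M = (1ℚ + b⁺) ^ ∣ S ∣
      b≤b⊔0 : b ≤ b⁺
      b≤b⊔0 = ℚ.p≤p⊔q b 0ℚ
      0≤M : 0ℚ ≤ M
      0≤M = ^-nonNeg ∣ S ∣ (+-nonNeg (ℚ.<⇒≤ 0<1) (ℚ.p≤q⊔p b 0ℚ))
      M≤1+M : M ≤ 1ℚ + M
      M≤1+M = subst (_≤ 1ℚ + M) (ℚ.+-identityˡ M) (ℚ.+-monoˡ-≤ M (ℚ.<⇒≤ 0<1))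

    sign : Fin n → ℚ
    sign x = if side x then 1ℚ else neg 1ℚ

    sign-≡ : ∀ {x y} → side x ≡ side y → sign x * sign y ≡ 1ℚ
    sign-≡ {x} {y} eq with side x | side y
    sign-≡ refl | true  | true  = refl
    sign-≡ refl | false | false = refl

    sign-≢ : ∀ {x y} → side x ≢ side y → sign x ≡ neg (sign y)
    sign-≢ {x} {y} neq with side x | side y
    ... | true  | true  = contradiction refl neq
    ... | true  | false = refl
    ... | false | true  = refl
    ... | false | false = contradiction refl neq

    -- Up to normalisation, the covariance of u ∉ I and w ∉ I in the subgraph
    -- induced on S. The sign makes the claim corr ≥ 0 uniform: vertices on the
    -- same side are positively correlated, vertices on opposite sides negatively.
    corr : Subset n → Fin n → Fin n → T → ℚ
    corr S u w τ = sign u * sign w * (Z τ S * Z τ (S - u - w) − Z τ (S - u) * Z τ (S - w))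

    -- The analogue of `corr` for the event that no vertex of `xs` is occupied, with the sign `c`
    -- prescribed from outside.
    corrs : Subset n → List (Fin n) → Fin n → ℚ → T → ℚ
    corrs S xs w c τ = c * (Z τ S * Z τ (S ∖∖ xs - w) − Z τ (S ∖∖ xs) * Z τ (S - w))

    CorrPositive : Subset n → Set
    CorrPositive S = ∀ u w → (∀ τ → 0ℚ ≤ corr S u w τ) × (Path S u w → UniformlyPositive (corr S u w))

    -- The telescoping step. Conditioning on `xs` being unoccupied amounts to deleting `xs`, so
    -- adding `y` contributes the covariance of `y` and `w` in the smaller graph. The factors `Z`
    -- clear denominators.
    corrs-∷ : ∀ S y xs w τ →
      Z τ (S ∖∖ xs) * corrs S (y ∷ xs) w (sign y * sign w) τ ≡
      Z τ (S ∖∖ xs - y) * corrs S xs w (sign y * sign w) τ + Z τ S * corr (S ∖∖ xs) y w τ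
    corrs-∷ S y xs w τ = solve 7
      (λ c a₀ b₀ a b a′ b′ → a :* (c :* (a₀ :* b′ :- a′ :* b₀))
         := a′ :* (c :* (a₀ :* b :- a :* b₀)) :+ a₀ :* (c :* (a :* b′ :- a′ :* b)))
      refl (sign y * sign w) (Z τ S) (Z τ (S - w)) (Z τ (S ∖∖ xs)) (Z τ (S ∖∖ xs - w))
           (Z τ (S ∖∖ xs - y)) (Z τ (S ∖∖ xs - y - w))

    module _ (S : Subset n) (w : Fin n) (c : ℚ) (corr⁺ : ∀ S′ → S′ ⊆ S → CorrPositive S′) where

      corrs-nonNeg : ∀ xs → (∀ x → x List.∈ xs → sign x * sign w ≡ c) → ∀ τ → 0ℚ ≤ corrs S xs w c τ
      corrs-nonNeg [] _ τ = ℚ.≤-reflexive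
        (solve 3 (λ c a b → con 0ℚ := c :* (a :* b :- a :* b)) refl c (Z τ S) (Z τ (S - w)))
      corrs-nonNeg (y ∷ xs) eq τ with refl ← eq y (here refl) =
        *-cancel-nonNeg (corrs S (y ∷ xs) w c τ) (0<Z τ (S ∖∖ xs)) (subst (0ℚ ≤_) (sym (corrs-∷ S y xs w τ))
          (+-nonNeg (*-nonNeg (0≤Z τ (S ∖∖ xs - y)) (corrs-nonNeg xs (λ x → eq x ∘ there) τ))
                    (*-nonNeg (0≤Z τ S) (proj₁ (corr⁺ (S ∖∖ xs) (∖∖-⊆ S xs) y w) τ))))

      -- As the vertices of the list are deleted, the path from `x` to `w` survives until some `y`
      -- on it is reached. The rest of the path then joins `y` to `w` in the current graph, which
      -- makes that term of the telescoping sum strictly positive.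
      corrs-positive : ∀ {x} → Path S x w → ∀ xs → (∀ x → x List.∈ xs → sign x * sign w ≡ c) →
        UniformlyPositive (corrs S xs w c) ⊎ Path (S ∖∖ xs) x w
      corrs-positive p [] _ = inj₂ p
      corrs-positive p (y ∷ xs) eq with refl ← eq y (here refl) | corrs-positive p xs (λ x → eq x ∘ there)
      ... | inj₁ tail₊ = inj₁ (Z-cancel (S ∖∖ xs) (UP-≡ (λ τ → sym (corrs-∷ S y xs w τ))
        (UP-+ {λ τ → Z τ (S ∖∖ xs - y) * corrs S xs w c τ} (UP-* (Z-UP (S ∖∖ xs - y)) tail₊)
          λ τ → *-nonNeg (0≤Z τ S) (proj₁ (corr⁺ (S ∖∖ xs) (∖∖-⊆ S xs) y w) τ))))
      ... | inj₂ p′ with shortcut-or-avoid y p′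
      ...   | inj₂ p″  = inj₂ p″
      ...   | inj₁ p-y = inj₁ (Z-cancel (S ∖∖ xs)
        (UP-≡ (λ τ → trans (ℚ.+-comm (Z τ S * corr (S ∖∖ xs) y w τ) (Z τ (S ∖∖ xs - y) * corrs S xs w c τ))
                           (sym (corrs-∷ S y xs w τ)))
          (UP-+ {λ τ → Z τ S * corr (S ∖∖ xs) y w τ}
            (UP-* (Z-UP S) (proj₂ (corr⁺ (S ∖∖ xs) (∖∖-⊆ S xs) y w) p-y))
            λ τ → *-nonNeg (0≤Z τ (S ∖∖ xs - y)) (corrs-nonNeg xs (λ x → eq x ∘ there) τ))))

      -- A path starting at `x` cannot survive the deletion of `x`, so only the strict alternative
      -- remains.
      corrs-positive-∈ : ∀ {x} xs → x List.∈ xs → Path S x w → (∀ x → x List.∈ xs → sign x * sign w ≡ c) →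
        UniformlyPositive (corrs S xs w c)
      corrs-positive-∈ xs x∈xs p eq with corrs-positive p xs eq
      ... | inj₁ up = up
      ... | inj₂ p′ = contradiction x∈xs (∈-∖∖⁻ xs (Path-start p′))

    ─neighbours≡∖∖ : ∀ S u → S ─ neighbours u ≡ S ∖∖ neighbourList u
    ─neighbours≡∖∖ S u = ⊆-antisym
      (λ y∈ → ∈-∖∖⁺ (neighbourList u) (p─q⊆p S (neighbours u) y∈)
        λ y∈l → x∈p─q⇒x∉q S (neighbours u) y∈ (lookup-∈ y∈l))
      (λ y∈ → x∈p∧x∉q⇒x∈p─q (∖∖-⊆ S (neighbourList u) y∈)
        λ y∈N → ∈-∖∖⁻ (neighbourList u) y∈ (∈-neighbourList⁺ (∈⇒~ y∈N)))
      where
      -- Membership in a neighbourhood does not involve the fugacity; `0ℚ` is an arbitrary choice.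
      open PartitionFunction G 0ℚ renaming (∈-neighbours⁺ to ~⇒∈; ∈-neighbours⁻ to ∈⇒~) using ()
      lookup-∈ : ∀ {y} → y List.∈ neighbourList u → y ∈ neighbours u
      lookup-∈ = ~⇒∈ ∘ ∈-neighbourList⁻

    -- The case of a variance: removing `w` twice is removing it once, and `Z-step` leaves a product
    -- of positive quantities.
    corr-diagonal : ∀ {S w} → w ∈ S → ∀ τ →
      Z τ (S - w) * (q τ * Z τ (S - w ─ neighbours w)) ≡ corr S w w τ
    corr-diagonal {S} {w} w∈S τ = sym (begin
      sign w * sign w * (Z τ S * Z τ (S - w - w) − Z τ (S - w) * Z τ (S - w))
        ≡⟨ cong₂ (λ s S′ → s * (Z τ S * Z τ S′ − Z τ (S - w) * Z τ (S - w)))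
             (sign-≡ {w} refl) (x∉p⇒p-x≡p (x∉p-x S)) ⟩
      1ℚ * (Z τ S * Z τ (S - w) − Z τ (S - w) * Z τ (S - w))
        ≡⟨ cong (λ t → 1ℚ * (t * Z τ (S - w) − Z τ (S - w) * Z τ (S - w))) (Z-step τ w∈S) ⟩
      1ℚ * ((Z τ (S - w) + q τ * Z τ (S - w ─ neighbours w)) * Z τ (S - w) − Z τ (S - w) * Z τ (S - w))
        ≡⟨ solve 2 (λ a c → con 1ℚ :* ((a :+ c) :* a :- a :* a) := a :* c) refl
             (Z τ (S - w)) (q τ * Z τ (S - w ─ neighbours w)) ⟩
      Z τ (S - w) * (q τ * Z τ (S - w ─ neighbours w)) ∎)
      where open ≡-Reasoning

    -- Expanding `Z τ S` and `Z τ (S - w)` at `u`, the products without a factor q cancel. What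
    -- remains is -q times the covariance of `w` with the event that all neighbours of `u` are
    -- unoccupied, in the graph without `u`. The minus sign matches the change of side from `u` to
    -- its neighbours.
    corr-step : ∀ {S u w} → u ∈ S → u ≢ w → ∀ τ →
      q τ * corrs (S - u) (neighbourList u) w (neg (sign u * sign w)) τ ≡ corr S u w τ
    corr-step {S} {u} {w} u∈S u≢w τ = sym (begin
      sign u * sign w * (Z τ S * Z τ (S - u - w) − Z τ (S - u) * Z τ (S - w))
        ≡⟨ cong₂ (λ s t → sign u * sign w * (s * Z τ (S - u - w) − Z τ (S - u) * t)) ZS ZS-w ⟩
      sign u * sign w * ((a₀ + q τ * aₖ) * b₀ − a₀ * (b₀ + q τ * bₖ))
        ≡⟨ solve 6 (λ s a₀ b₀ aₖ bₖ z → s :* ((a₀ :+ z :* aₖ) :* b₀ :- a₀ :* (b₀ :+ z :* bₖ))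
             := z :* ((:- s) :* (a₀ :* bₖ :- aₖ :* b₀))) refl (sign u * sign w) a₀ b₀ aₖ bₖ (q τ) ⟩
      q τ * corrs (S - u) (neighbourList u) w (neg (sign u * sign w)) τ ∎)
      where
      open ≡-Reasoning
      a₀ b₀ aₖ bₖ : ℚ
      a₀ = Z τ (S - u)
      b₀ = Z τ (S - u - w)
      aₖ = Z τ (S - u ∖∖ neighbourList u)
      bₖ = Z τ (S - u ∖∖ neighbourList u - w)
      ZS : Z τ S ≡ a₀ + q τ * aₖ
      ZS = trans (Z-step τ u∈S) (cong (λ U → a₀ + q τ * Z τ U) (─neighbours≡∖∖ (S - u) u))
      ZS-w : Z τ (S - w) ≡ b₀ + q τ * bₖ
      ZS-w = begin
        Z τ (S - w)
          ≡⟨ Z-step τ (x∈p∧x≢y⇒x∈p-y u∈S u≢w) ⟩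
        Z τ (S - w - u) + q τ * Z τ (S - w - u ─ neighbours u)
          ≡⟨ cong (λ U → Z τ U + q τ * Z τ (U ─ neighbours u)) (p─x─y≡p─y─x S w u) ⟩
        b₀ + q τ * Z τ (S - u - w ─ neighbours u)
          ≡⟨ cong (λ U → b₀ + q τ * Z τ U) (p─q─r≡p─r─q (S - u) ⁅ w ⁆ (neighbours u)) ⟩
        b₀ + q τ * Z τ ((S - u ─ neighbours u) - w)
          ≡⟨ cong (λ U → b₀ + q τ * Z τ (U - w)) (─neighbours≡∖∖ (S - u) u) ⟩
        b₀ + q τ * bₖ ∎

    -- Induction on `S`. The covariance vanishes for `u` outside `S` and is a variance for `u` equal
    -- to `w`. Otherwise `corr-step` passes to `S - u`, where the tail of a path from `u` to `w` is
    -- a path from a neighbour of `u`.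
    corr-positive : ∀ S → CorrPositive S
    corr-positive S = go S (⊂-wellFounded S)
      where
      go : ∀ S → Acc _⊂_ S → CorrPositive S
      go S (acc rec) u w with u ∈? S
      ... | no u∉S = (λ τ → ℚ.≤-reflexive (sym (vanish τ))) , λ p → contradiction (Path-start p) u∉S
        where
        vanish : ∀ τ → corr S u w τ ≡ 0ℚ
        vanish τ = trans
          (cong (λ U → sign u * sign w * (Z τ S * Z τ (U - w) − Z τ U * Z τ (S - w))) (x∉p⇒p-x≡p u∉S))
          (solve 3 (λ s a b → s :* (a :* b :- a :* b) := con 0ℚ) refl (sign u * sign w) (Z τ S) (Z τ (S - w)))
      ... | yes u∈S with u ≟ w
      ...   | yes refl = (λ τ → ℚ.≤-trans (ℚ.<⇒≤ 0<ε) (ε≤ τ)) , λ _ → ε , 0<ε , ε≤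
        where
        diagonal₊ : UniformlyPositive (corr S u u)
        diagonal₊ = UP-≤ (UP-* (Z-UP (S - u)) (UP-* q-UP (Z-UP (S - u ─ neighbours u))))
                         (λ τ → ℚ.≤-reflexive (corr-diagonal u∈S τ))
        ε : ℚ
        ε = proj₁ diagonal₊
        0<ε : 0ℚ < ε
        0<ε = proj₁ (proj₂ diagonal₊)
        ε≤ : ∀ τ → ε ≤ corr S u u τ
        ε≤ = proj₂ (proj₂ diagonal₊)
      ...   | no u≢w = (λ τ → subst (0ℚ ≤_) (corr-step u∈S u≢w τ)
                         (*-nonNeg (0≤q τ) (corrs-nonNeg (S - u) w c smaller (neighbourList u) signs τ)))
                     , pos
        where
        c : ℚ
        c = neg (sign u * sign w)
        smaller : ∀ S′ → S′ ⊆ S - u → CorrPositive S′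
        smaller S′ S′⊆ = go S′ (rec (⊆-⊂-trans S′⊆ (x∈p⇒p-x⊂p u∈S)))
        -- All neighbours of `u` lie on the side opposite to `u`, so a single constant `c` serves
        -- the whole list.
        signs : ∀ x → x List.∈ neighbourList u → sign x * sign w ≡ c
        signs x x∈ = trans
          (cong (_* sign w) (sign-≢ {x} {u} (bipartite x u (sym-~ (∈-neighbourList⁻ x∈)))))
          (sym (ℚ.neg-distribˡ-* (sign u) (sign w)))
        pos : Path S u w → UniformlyPositive (corr S u w)
        pos (stop _) = contradiction refl u≢w
        pos (step _ u~x p) = UP-≤
          (UP-* q-UP (corrs-positive-∈ (S - u) w c smaller (neighbourList u) (∈-neighbourList⁺ u~x) p signs))
          (λ τ → ℚ.≤-reflexive (corr-step u∈S u≢w τ))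

-- Double counting of edges in a component.

module DoubleCounting where

  open import Data.Fin.Subset
  open import Data.Fin.Subset.Properties
  open import Data.Nat.Base using (_+_; _*_)
  open import Defs using (Graph)
  open PartitionFunctions using (x∉p-x)
  open Correlations using (module Connectivity)

  𝟙 : ∀ {P : Set} → Dec P → ℕ
  𝟙 P? = if does P? then 1 else 0

  𝟙-true : ∀ {P : Set} (P? : Dec P) → P → 𝟙 P? ≡ 1
  𝟙-true P? p = cong (if_then 1 else 0) (dec-true P? p)

  𝟙-false : ∀ {P : Set} (P? : Dec P) → ¬ P → 𝟙 P? ≡ 0
  𝟙-false P? ¬p = cong (if_then 1 else 0) (dec-false P? ¬p)

  sum-𝟙-≟ : ∀ {n} (v : Fin n) → sum (λ y → 𝟙 (y ≟ v)) ≡ 1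
  sum-𝟙-≟ {suc n} zero    = cong suc (sum-replicate-zero n)
  sum-𝟙-≟ {suc n} (suc v) = sum-𝟙-≟ v

  ∣tabulate∣≡sum : ∀ {n} {P : Pred (Fin n) 0ℓ} (P? : Decidable P) → ∣ tabulate (does ∘ P?) ∣ ≡ sum (𝟙 ∘ P?)
  ∣tabulate∣≡sum {zero}  P? = refl
  ∣tabulate∣≡sum {suc n} P? with does (P? zero)
  ... | true  = cong suc (∣tabulate∣≡sum (P? ∘ suc))
  ... | false = ∣tabulate∣≡sum (P? ∘ suc)

  length-filter-tabulate : ∀ {A : Set} {n} {P : Pred A 0ℓ} (P? : Decidable P) (f : Fin n → A) →
    length (filter P? (tabulateList f)) ≡ ∣ tabulate (does ∘ P? ∘ f) ∣
  length-filter-tabulate {n = zero}  P? f = refl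
  length-filter-tabulate {n = suc n} P? f with does (P? (f zero))
  ... | true  = cong suc (length-filter-tabulate P? (f ∘ suc))
  ... | false = length-filter-tabulate P? (f ∘ suc)

  module Counting {n : ℕ} (G : Graph n) {d : ℕ} (2≤d : 2 ℕ.≤ d) (regular : Graph.Regular G d)
    (side : Fin n → Bool) (bipartite : ∀ u v → Graph._~_ G u v → side u ≢ side v) where

    open Graph G
    open Connectivity G

    length-neighbourList : ∀ v → length (neighbourList v) ≡ d
    length-neighbourList v = trans (length-filter-tabulate (v ~?_) id) (regular v)

    degree : ∀ x → sum (λ y → 𝟙 (x ~? y)) ≡ d
    degree x = trans (sym (∣tabulate∣≡sum (x ~?_))) (regular x)

    side-≢-≢ : ∀ {x y z} → side x ≢ side y → side y ≢ side z → side x ≡ side z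
    side-≢-≢ x≢y y≢z = trans (Bool.¬-not x≢y) (sym (Bool.¬-not (y≢z ∘ sym)))

    -- If the component C of u in G − v contained no other neighbour of v, then
    -- counting the edges of C from both sides would give d |A| + 1 = d |B|,
    -- where A and B are the two colour classes of C.
    path-avoiding : ∀ v u us → neighbourList v ≡ u ∷ us → ∃[ x ] (x List.∈ us × Path (⊤ - v) x u)
    path-avoiding v u us nbrs with Any.any? (λ x → path? (⊤ - v) x u) us
    ... | yes found with x , x∈us , p ← List.find found = x , x∈us , p
    ... | no  none  = contradiction (sym (∣1⇒≡1 d∣1)) (ℕ.<⇒≢ 2≤d)
      where
      open ≡-Reasoning

      v~u : v ~ u
      v~u = ∈-neighbourList⁻ (subst (u List.∈_) (sym nbrs) (here refl))

      ∈⊤-v : ∀ {x} → x ≢ v → x ∈ ⊤ - v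
      ∈⊤-v = x∈p∧x≢y⇒x∈p-y ∈⊤

      A B : Pred (Fin n) 0ℓ
      A y = Path (⊤ - v) y u × side y ≢ side u
      B x = Path (⊤ - v) x u × side x ≡ side u

      u∈B : B u
      u∈B = stop (∈⊤-v λ { refl → irrefl refl v~u }) , refl

      -- As parameters the two decision procedures stay opaque during the counting; `path?` supplies
      -- them in `d∣1`.
      module _ (A? : Decidable A) (B? : Decidable B) where

        edge : Fin n → Fin n → ℕ
        edge x y = 𝟙 (B? x) * (𝟙 (x ~? y) * 𝟙 (A? y))

        -- Every neighbour of a vertex in `B` lies in `A`, with the exception of `v`. By assumption
        -- `u` is the only vertex of the component adjacent to `v`, so `𝟙 (x ≟ u)` restores exactly
        -- the missing edge.
        edges-from-B : ∀ x → sum (edge x) + 𝟙 (x ≟ u) ≡ 𝟙 (B? x) * d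
        edges-from-B x with B? x
        ... | no x∉B = cong₂ _+_ (sum-replicate-zero n) (𝟙-false (x ≟ u) λ { refl → x∉B u∈B })
        ... | yes (p , x≈u) = begin
          sum (λ y → 1 * (𝟙 (x ~? y) * 𝟙 (A? y))) + 𝟙 (x ≟ u)
            ≡⟨ cong₂ _+_ (sum-cong-≗ λ y → ℕ.*-identityˡ (𝟙 (x ~? y) * 𝟙 (A? y))) split-𝟙 ⟩
          sum (λ y → 𝟙 (x ~? y) * 𝟙 (A? y)) + sum (λ y → 𝟙 (x ≟ u) * 𝟙 (y ≟ v))
            ≡⟨ sum-distrib-+ (λ y → 𝟙 (x ~? y) * 𝟙 (A? y)) (λ y → 𝟙 (x ≟ u) * 𝟙 (y ≟ v)) ⟨
          sum (λ y → 𝟙 (x ~? y) * 𝟙 (A? y) + 𝟙 (x ≟ u) * 𝟙 (y ≟ v))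
            ≡⟨ sum-cong-≗ pointwise ⟩
          sum (λ y → 𝟙 (x ~? y))
            ≡⟨ degree x ⟩
          d
            ≡⟨ ℕ.*-identityˡ d ⟨
          1 * d ∎
          where
          split-𝟙 : 𝟙 (x ≟ u) ≡ sum (λ y → 𝟙 (x ≟ u) * 𝟙 (y ≟ v))
          split-𝟙 = trans (sym (ℕ.*-identityʳ (𝟙 (x ≟ u))))
            (trans (cong (𝟙 (x ≟ u) *_) (sym (sum-𝟙-≟ v))) (*-distribˡ-sum (𝟙 (x ≟ u)) (λ y → 𝟙 (y ≟ v))))
          ~v⇒≡u : x ~ v → x ≡ u
          ~v⇒≡u x~v with subst (x List.∈_) nbrs (∈-neighbourList⁺ (sym-~ x~v))
          ... | here x≡u   = x≡u
          ... | there x∈us = contradiction (List.lose x∈us p) none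
          pointwise : ∀ y → 𝟙 (x ~? y) * 𝟙 (A? y) + 𝟙 (x ≟ u) * 𝟙 (y ≟ v) ≡ 𝟙 (x ~? y)
          pointwise y with x ~? y | y ≟ v
          ... | yes x~v | yes refl = cong₂ (λ a b → 1 * a + b * 1)
            (𝟙-false (A? v) λ (p′ , _) → x∉p-x ⊤ (Path-start p′)) (𝟙-true (x ≟ u) (~v⇒≡u x~v))
          ... | yes x~y | no  y≢v  = cong₂ (λ a b → 1 * a + b)
            (𝟙-true (A? y) (Path-cons (∈⊤-v y≢v) (sym-~ x~y) p ,
              λ y≈u → bipartite x y x~y (trans x≈u (sym y≈u))))
            (ℕ.*-zeroʳ (𝟙 (x ≟ u)))
          ... | no  x≁v | yes refl = cong (_* 1) (𝟙-false (x ≟ u) λ { refl → x≁v (sym-~ v~u) })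
          ... | no  _   | no  _    = ℕ.*-zeroʳ (𝟙 (x ≟ u))

        -- No edge is missing here: `v` and the vertices of `A` are both on the side opposite to
        -- `u`, hence not adjacent, and all neighbours of a vertex in `A` lie in `B`.
        edges-from-A : ∀ y → sum (λ x → edge x y) ≡ 𝟙 (A? y) * d
        edges-from-A y with A? y
        ... | no  _         = trans
          (sum-cong-≗ λ x → trans (cong (𝟙 (B? x) *_) (ℕ.*-zeroʳ (𝟙 (x ~? y)))) (ℕ.*-zeroʳ (𝟙 (B? x))))
          (sum-replicate-zero n)
        ... | yes (p , y≉u) = trans (sum-cong-≗ pointwise) (trans (degree y) (sym (ℕ.*-identityˡ d)))
          where
          pointwise : ∀ x → 𝟙 (B? x) * (𝟙 (x ~? y) * 1) ≡ 𝟙 (y ~? x)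
          pointwise x with x ~? y
          ... | no  x≁y = trans (ℕ.*-zeroʳ (𝟙 (B? x))) (sym (𝟙-false (y ~? x) (x≁y ∘ sym-~)))
          ... | yes x~y = trans (ℕ.*-identityʳ (𝟙 (B? x))) (trans (𝟙-true (B? x)
            (Path-cons (∈⊤-v λ { refl → bipartite _ y x~y (side-≢-≢ (bipartite _ u v~u) (y≉u ∘ sym)) }) x~y p , side-≢-≢ (bipartite x y x~y) y≉u))
            (sym (𝟙-true (y ~? x) (sym-~ x~y))))

        total : sum (𝟙 ∘ A?) * d + 1 ≡ sum (𝟙 ∘ B?) * d
        total = begin
          sum (𝟙 ∘ A?) * d + 1
            ≡⟨ cong₂ _+_ (*-distribʳ-sum d (𝟙 ∘ A?)) (sym (sum-𝟙-≟ u)) ⟩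
          sum (λ y → 𝟙 (A? y) * d) + sum (λ x → 𝟙 (x ≟ u))
            ≡⟨ cong (_+ sum (λ x → 𝟙 (x ≟ u))) (sum-cong-≗ edges-from-A) ⟨
          sum (λ y → sum (λ x → edge x y)) + sum (λ x → 𝟙 (x ≟ u))
            ≡⟨ cong (_+ sum (λ x → 𝟙 (x ≟ u))) (∑-comm (λ y x → edge x y)) ⟩
          sum (λ x → sum (edge x)) + sum (λ x → 𝟙 (x ≟ u))
            ≡⟨ sum-distrib-+ (λ x → sum (edge x)) (λ x → 𝟙 (x ≟ u)) ⟨
          sum (λ x → sum (edge x) + 𝟙 (x ≟ u))
            ≡⟨ sum-cong-≗ edges-from-B ⟩
          sum (λ x → 𝟙 (B? x) * d)
            ≡⟨ *-distribʳ-sum d (𝟙 ∘ B?) ⟨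
          sum (𝟙 ∘ B?) * d ∎

        d∣1′ : d ∣ 1
        d∣1′ = ∣m+n∣m⇒∣n (subst (d ∣_) (sym total) (n∣m*n (sum (𝟙 ∘ B?)))) (n∣m*n (sum (𝟙 ∘ A?)))

      d∣1 : d ∣ 1
      d∣1 = d∣1′ (λ y → path? (⊤ - v) y u ×-dec ¬? (side y Bool.≟ side u))
                 (λ x → path? (⊤ - v) x u ×-dec (side x Bool.≟ side u))

-- The strict tree inequality at rational fugacities, with a uniform gap.

module Gap where

  open import Data.Fin.Subset
  open import Data.Fin.Subset.Properties
  open import Data.Rational.Base
    using (ℚ; 0ℚ; 1ℚ; _+_; _*_; _<_; _≤_) renaming (_-_ to _−_)
  open import Defs using (Graph; recip)
  open Rationals
  open PartitionFunctions
  open Correlations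
  open DoubleCounting

  -- With P = Z ⊤, the occupancy fraction is A / P, every vertex is unoccupied
  -- with probability Y / P, and the two ends of an edge are both unoccupied with
  -- probability X / P.
  module UniformGap {n : ℕ} (G : Graph n) {d : ℕ} (2≤d : 2 ℕ.≤ d)
    (regular : Graph.Regular G d) (transitive : Graph.VertexTransitive G)
    (side : Fin n → Bool) (bipartite : ∀ u v → Graph._~_ G u v → side u ≢ side v)
    {T : Set} (q : T → ℚ) {δ b : ℚ} (0<δ : 0ℚ < δ) (δ≤q : ∀ τ → δ ≤ q τ) (q≤b : ∀ τ → q τ ≤ b)
    (v : Fin n) where

    open Graph G
    open Connectivity G
    open UniformBounds {T}
    open Correlation G side bipartite q 0<δ δ≤q q≤b
    open Counting G 2≤d regular side bipartite
    open ≡-Reasoning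

    Y A X : T → ℚ
    Y τ = Z τ (⊤ - v)
    A τ = q τ * Z τ (⊤ - v ─ neighbours v)
    X τ = Y τ − A τ

    Z⊤ : ∀ τ → Z τ ⊤ ≡ Y τ + A τ
    Z⊤ τ = Z-step τ ∈⊤

    0≤A : ∀ τ → 0ℚ ≤ A τ
    0≤A τ = *-nonNeg (0≤q τ) (0≤Z τ (⊤ - v ─ neighbours v))

    Z[⊤-w]≡Y : ∀ w τ → Z τ (⊤ - w) ≡ Y τ
    Z[⊤-w]≡Y w τ with σ , aut , refl ← transitive w v = PF.Z-permute τ {σ} aut λ y → mk⇔
      (λ y∈ → x∈p∧x≢y⇒x∈p-y ∈⊤ λ eq → x∉p-x ⊤ (subst (_∈ ⊤ - w) (σ-injective σ eq) y∈))
      (λ σy∈ → x∈p∧x≢y⇒x∈p-y ∈⊤ λ { refl → x∉p-x ⊤ σy∈ })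

    -- Expand `Y` at `u`. As `v` is a neighbour of `u`, deleting `v` first does not change the term
    -- in which `u` is occupied, and that term is `A` by vertex-transitivity.
    Z[⊤-v-u]≡X : ∀ {u} → v ~ u → ∀ τ → Z τ (⊤ - v - u) ≡ X τ
    Z[⊤-v-u]≡X {u} v~u τ = begin
      Z τ (⊤ - v - u)
        ≡⟨ solve 2 (λ a c → a := a :+ c :- c) refl (Z τ (⊤ - v - u)) (q τ * Z τ (⊤ - u ─ neighbours u)) ⟩
      Z τ (⊤ - v - u) + q τ * Z τ (⊤ - u ─ neighbours u) − q τ * Z τ (⊤ - u ─ neighbours u)
        ≡⟨ cong₂ _−_ (sym Y≡) Aᵤ≡A ⟩
      X τ ∎
      where
      v∉ : v ∉ ⊤ - u ─ neighbours u
      v∉ v∈ = x∈p─q⇒x∉q (⊤ - u) (neighbours u) v∈ (∈-neighbours⁺ τ (sym-~ v~u))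
      removed : ⊤ - v - u ─ neighbours u ≡ ⊤ - u ─ neighbours u
      removed = begin
        ⊤ - v - u ─ neighbours u      ≡⟨ cong (_─ neighbours u) (p─x─y≡p─y─x ⊤ v u) ⟩
        ⊤ - u - v ─ neighbours u      ≡⟨ p─q─r≡p─r─q (⊤ - u) ⁅ v ⁆ (neighbours u) ⟩
        (⊤ - u ─ neighbours u) - v    ≡⟨ x∉p⇒p-x≡p v∉ ⟩
        ⊤ - u ─ neighbours u          ∎
      Y≡ : Y τ ≡ Z τ (⊤ - v - u) + q τ * Z τ (⊤ - u ─ neighbours u)
      Y≡ = trans (Z-step τ (x∈p∧x≢y⇒x∈p-y ∈⊤ λ { refl → irrefl refl v~u }))
                 (cong (λ S → Z τ (⊤ - v - u) + q τ * Z τ S) removed)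
      Aᵤ≡A : q τ * Z τ (⊤ - u ─ neighbours u) ≡ A τ
      Aᵤ≡A = begin
        q τ * Z τ (⊤ - u ─ neighbours u)
          ≡⟨ solve 2 (λ a c → c := a :+ c :- a) refl (Z τ (⊤ - u)) (q τ * Z τ (⊤ - u ─ neighbours u)) ⟩
        Z τ (⊤ - u) + q τ * Z τ (⊤ - u ─ neighbours u) − Z τ (⊤ - u)
          ≡⟨ cong₂ _−_ (trans (sym (Z-step τ ∈⊤)) (Z⊤ τ)) (Z[⊤-w]≡Y u τ) ⟩
        Y τ + A τ − Y τ
          ≡⟨ solve 2 (λ a c → a :+ c :- a := c) refl (Y τ) (A τ) ⟩
        A τ ∎

    -- Given that `v` is unoccupied, the probability that all of `us` are unoccupied minus the
    -- product of the single probabilities X / Y, multiplied by Y to the power k + 1, where k is the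
    -- length of `us`.
    product-gap : List (Fin n) → T → ℚ
    product-gap us τ = Z τ (⊤ - v ∖∖ us) * Y τ ^ length us − X τ ^ length us * Y τ

    -- Splits off `u`: its covariance with the event that `us` is unoccupied, in the graph without
    -- `v`, plus a multiple of the gap for `us`.
    product-gap-∷ : ∀ u us → v ~ u → ∀ τ → product-gap (u ∷ us) τ ≡
      Y τ ^ length us * corrs (⊤ - v) us u 1ℚ τ + X τ * product-gap us τ
    product-gap-∷ u us v~u τ = trans
      (solve 6 (λ y x a a′ yᵏ xᵏ → a′ :* (y :* yᵏ) :- x :* xᵏ :* y
          := yᵏ :* (con 1ℚ :* (y :* a′ :- a :* x)) :+ x :* (a :* yᵏ :- xᵏ :* y))
        refl (Y τ) (X τ) (Z τ (⊤ - v ∖∖ us)) (Z τ (⊤ - v ∖∖ us - u)) (Y τ ^ length us) (X τ ^ length us))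
      (cong (λ x → Y τ ^ length us * (1ℚ * (Y τ * Z τ (⊤ - v ∖∖ us - u) − Z τ (⊤ - v ∖∖ us) * x))
                   + X τ * product-gap us τ) (sym (Z[⊤-v-u]≡X v~u τ)))

    signs-agree : ∀ {x u} → v ~ x → v ~ u → sign x * sign u ≡ 1ℚ
    signs-agree {x} {u} v~x v~u = sign-≡ {x} {u}
      (side-≢-≢ (bipartite x v (sym-~ v~x)) (bipartite v u v~u))

    corr⁺ : ∀ S′ → S′ ⊆ ⊤ - v → CorrPositive S′
    corr⁺ S′ _ = corr-positive S′

    0≤Y^k : ∀ k τ → 0ℚ ≤ Y τ ^ k
    0≤Y^k k τ = ^-nonNeg k (0≤Z τ (⊤ - v))

    0≤X : ∀ {u} → v ~ u → ∀ τ → 0ℚ ≤ X τ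
    0≤X {u} v~u τ = subst (0ℚ ≤_) (Z[⊤-v-u]≡X v~u τ) (0≤Z τ (⊤ - v - u))

    product-gap-nonNeg : ∀ us → (∀ u → u List.∈ us → v ~ u) → ∀ τ → 0ℚ ≤ product-gap us τ
    product-gap-nonNeg [] _ τ = ℚ.≤-reflexive
      (solve 1 (λ y → con 0ℚ := y :* con 1ℚ :- con 1ℚ :* y) refl (Y τ))
    product-gap-nonNeg (u ∷ us) v~ τ = subst (0ℚ ≤_) (sym (product-gap-∷ u us (v~ u (here refl)) τ))
      (+-nonNeg
        (*-nonNeg (0≤Y^k (length us) τ)
          (corrs-nonNeg (⊤ - v) u 1ℚ corr⁺ us (λ x x∈ → signs-agree (v~ x (there x∈)) (v~ u (here refl))) τ))
        (*-nonNeg (0≤X (v~ u (here refl)) τ) (product-gap-nonNeg us (λ x → v~ x ∘ there) τ)))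

    -- Strictness comes from the covariance term of the first neighbour `u`, which is joined to
    -- another neighbour of `v` by a path avoiding `v`. The remaining terms only have to be
    -- nonnegative.
    product-gap-positive : ∀ us → neighbourList v ≡ us → UniformlyPositive (product-gap us)
    product-gap-positive [] eq with () ← ℕ.≤-trans 2≤d
      (ℕ.≤-reflexive (trans (sym (length-neighbourList v)) (cong length eq)))
    product-gap-positive (u ∷ us) eq with x , x∈us , p ← path-avoiding v u us eq =
      UP-≡ (λ τ → sym (product-gap-∷ u us v~u τ))
        (UP-+ {λ τ → Y τ ^ length us * corrs (⊤ - v) us u 1ℚ τ}
          (UP-* (UP-^ (length us) (Z-UP (⊤ - v)))
            (corrs-positive-∈ (⊤ - v) u 1ℚ corr⁺ us x∈us p (λ x x∈ → signs-agree (v~ (there x∈)) v~u)))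
          (λ τ → *-nonNeg (0≤X v~u τ) (product-gap-nonNeg us (λ _ → v~ ∘ there) τ)))
      where
      v~ : ∀ {x} → x List.∈ u ∷ us → v ~ x
      v~ {x} x∈ = ∈-neighbourList⁻ (subst (x List.∈_) (sym eq) x∈)
      v~u : v ~ u
      v~u = v~ (here refl)

    -- With P = Y + A and a = A / P this is a / (1 - a).
    odds : T → ℚ
    odds τ = A τ * recip (Y τ)

    0≤odds : ∀ τ → 0ℚ ≤ odds τ
    0≤odds τ = *-nonNeg (0≤A τ) (ℚ.<⇒≤ (recip-pos (0<Z τ (⊤ - v))))

    some-neighbour : ∃[ u ] (v ~ u)
    some-neighbour with neighbourList v in eq
    ... | [] with () ← ℕ.≤-trans 2≤d
      (ℕ.≤-reflexive (trans (sym (length-neighbourList v)) (cong length eq)))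
    ... | u ∷ _ = u , ∈-neighbourList⁻ (subst (u List.∈_) (sym eq) (here refl))

    -- Both ends of an edge are unoccupied with nonnegative probability, so the occupancy fraction
    -- is at most one half.
    A≤Y : ∀ τ → A τ ≤ Y τ
    A≤Y τ = 0≤-⇒≤ (0≤X (proj₂ some-neighbour) τ)

    X/Y≡1-odds : ∀ τ → X τ * recip (Y τ) ≡ 1ℚ − odds τ
    X/Y≡1-odds τ = trans
      (solve 3 (λ y a r → (y :- a) :* r := y :* r :- a :* r) refl (Y τ) (A τ) (recip (Y τ)))
      (cong (_− odds τ) (recip-inverseʳ (0<Z τ (⊤ - v))))

    0≤1-odds : ∀ τ → 0ℚ ≤ 1ℚ − odds τ
    0≤1-odds τ = subst (0ℚ ≤_) (X/Y≡1-odds τ)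
      (*-nonNeg (0≤X (proj₂ some-neighbour) τ) (ℚ.<⇒≤ (recip-pos (0<Z τ (⊤ - v)))))

    Y^-cancel : ∀ k {g : T → ℚ} → UniformlyPositive (λ τ → Y τ ^ k * g τ) → UniformlyPositive g
    Y^-cancel zero    {g} g₊ = UP-≡ (λ τ → ℚ.*-identityˡ (g τ)) g₊
    Y^-cancel (suc k) {g} g₊ = Y^-cancel k (Z-cancel (⊤ - v)
      (UP-≡ (λ τ → ℚ.*-assoc (Y τ) (Y τ ^ k) (g τ)) g₊))

    -- Rewrites the gap for the full neighbourhood as the odds form s - q (1 - s)ᵈ of the tree
    -- equation, evaluated at `odds τ`.
    scaled-odds-gap : ∀ τ → q τ * product-gap (neighbourList v) τ ≡
                      Y τ ^ suc d * (odds τ − q τ * (1ℚ − odds τ) ^ d)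
    scaled-odds-gap τ = begin
      q τ * product-gap (neighbourList v) τ
        ≡⟨ cong₂ (λ S k → q τ * (Z τ S * y ^ k − x ^ k * y)) (sym (─neighbours≡∖∖ (⊤ - v) v)) (length-neighbourList v) ⟩
      q τ * (Z τ (⊤ - v ─ neighbours v) * y ^ d − x ^ d * y)
        ≡⟨ solve 5 (λ z w yᵈ xᵈ y → z :* (w :* yᵈ :- xᵈ :* y) := (z :* w) :* con 1ℚ :* yᵈ :- z :* xᵈ :* y)
             refl (q τ) (Z τ (⊤ - v ─ neighbours v)) (y ^ d) (x ^ d) y ⟩
      A τ * 1ℚ * y ^ d − q τ * x ^ d * y
        ≡⟨ cong₂ (λ s t → A τ * s * y ^ d − q τ * t * y) (sym y*r≡1) x^d≡ ⟩
      A τ * (y * r) * y ^ d − q τ * (y ^ d * (x * r) ^ d) * y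
        ≡⟨ solve 6 (λ a y r yᵈ z p → a :* (y :* r) :* yᵈ :- z :* (yᵈ :* p) :* y
             := y :* yᵈ :* (a :* r :- z :* p)) refl (A τ) y r (y ^ d) (q τ) ((x * r) ^ d) ⟩
      y ^ suc d * (odds τ − q τ * (x * r) ^ d)
        ≡⟨ cong (λ p → y ^ suc d * (odds τ − q τ * p ^ d)) (X/Y≡1-odds τ) ⟩
      y ^ suc d * (odds τ − q τ * (1ℚ − odds τ) ^ d) ∎
      where
      x y r : ℚ
      x = X τ
      y = Y τ
      r = recip y
      y*r≡1 : y * r ≡ 1ℚ
      y*r≡1 = recip-inverseʳ (0<Z τ (⊤ - v))
      x^d≡ : x ^ d ≡ y ^ d * (x * r) ^ d
      x^d≡ = begin
        x ^ d                    ≡⟨ cong (_^ d) (ℚ.*-identityʳ x) ⟨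
        (x * 1ℚ) ^ d             ≡⟨ cong (λ s → (x * s) ^ d) y*r≡1 ⟨
        (x * (y * r)) ^ d        ≡⟨ cong (_^ d) (solve 3 (λ x y r → x :* (y :* r) := y :* (x :* r)) refl x y r) ⟩
        (y * (x * r)) ^ d        ≡⟨ ^-distribʳ-* y (x * r) d ⟩
        y ^ d * (x * r) ^ d      ∎

    odds-gap : UniformlyPositive (λ τ → odds τ − q τ * (1ℚ − odds τ) ^ d)
    odds-gap = Y^-cancel (suc d) (UP-≡ scaled-odds-gap (UP-* q-UP (product-gap-positive (neighbourList v) refl)))

-- From rational terms to real numbers.

module Termwise where

  open import Data.Fin.Subset using (Subset; ⊤; _-_) renaming (∣_∣ to card)
  open import Data.Fin.Subset.Properties using (_∈?_)
  open import Data.Rational.Base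
    using (ℚ; mkℚ; 0ℚ; 1ℚ; _+_; _*_; _/_; _<_; _≤_; positive; nonNegative;
      ∣_∣) renaming (_-_ to _−_; -_ to neg_)
  open import Defs
    using (ℝ; seq; 0ℝ; Eventually; ∑[_]; Graph; module HardCore; IsTreeOccupancy; recip)
  import Defs as ℝ
  open Rationals
  open PartitionFunctions
  open Correlations
  open Gap

  seq-^ : ∀ x k m → seq (x ℝ.^ k) m ≡ seq x m ^ k
  seq-^ x zero    m = refl
  seq-^ x (suc k) m = cong (seq x m *_) (seq-^ x k m)

  seq-∑ : ∀ {A : Set} (xs : List A) f m → seq (∑[ xs ] f) m ≡ ∑ xs (λ x → seq (f x) m)
  seq-∑ []       f m = refl
  seq-∑ (x ∷ xs) f m = cong (seq (f x) m +_) (seq-∑ xs f m)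

  fromℕ-suc : ∀ k → ℤ.+ suc k / 1 ≡ 1ℚ + ℤ.+ k / 1
  fromℕ-suc k = sym (begin
    1ℚ + ℤ.+ k / 1                  ≡⟨ cong (1ℚ +_) (ℚ.normalize-coprime coprime) ⟩
    1ℚ + mkℚ (ℤ.+ k) 0 coprime      ≡⟨ cong (λ i → (1ℤ ℤ.+ i) / 1) (ℤ.*-identityʳ (ℤ.+ k)) ⟩
    ℤ.+ suc k / 1                   ∎)
    where
    open ≡-Reasoning
    1ℤ : ℤ.ℤ
    1ℤ = ℤ.+ 1
    coprime : ℕ.Coprime k 1
    coprime = ℕ.sym (ℕ.1-coprimeTo k)

  ∑-const : ∀ {A : Set} (xs : List A) c → ∑ xs (λ _ → c) ≡ ℤ.+ length xs / 1 * c
  ∑-const []       c = sym (ℚ.*-zeroˡ c)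
  ∑-const (x ∷ xs) c = trans (cong (c +_) (∑-const xs c)) (trans
    (solve 2 (λ l c → c :+ l :* c := (con 1ℚ :+ l) :* c) refl (ℤ.+ length xs / 1) c)
    (cong (_* c) (sym (fromℕ-suc (length xs)))))

  positive-fromℕ : ∀ n .{{_ : NonZero n}} → 0ℚ < ℤ.+ n / 1
  positive-fromℕ (suc n) = ℚ.positive⁻¹ (ℤ.+ suc n / 1) {{ℚ.normalize-pos (suc n) 1}}

  seq-average : ∀ n .{{_ : NonZero n}} (f : Fin n → ℝ) m c → (∀ v → seq (f v) m ≡ c) →
    seq (∑[ allFin n ] f) m * recip (ℤ.+ n / 1) ≡ c
  seq-average n f m c f≡c = begin
    seq (∑[ allFin n ] f) m * recip N                ≡⟨ cong (_* recip N) (seq-∑ (allFin n) f m) ⟩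
    ∑ (allFin n) (λ v → seq (f v) m) * recip N       ≡⟨ cong (_* recip N) (∑-cong (allFin n) f≡c) ⟩
    ∑ (allFin n) (λ _ → c) * recip N                 ≡⟨ cong (_* recip N) (∑-const (allFin n) c) ⟩
    ℤ.+ length (allFin n) / 1 * c * recip N          ≡⟨ cong (λ k → ℤ.+ k / 1 * c * recip N) (length-tabulate {n = n} (λ i → i)) ⟩
    N * c * recip N                                  ≡⟨ solve 3 (λ N r c → N :* c :* r := N :* (r :* c)) refl N (recip N) c ⟩
    N * (recip N * c)                                ≡⟨ *-recip-cancelˡ c (positive-fromℕ n) ⟩
    c                                                ∎
    where
    open ≡-Reasoning
    N : ℚ
    N = ℤ.+ n / 1

  module _ {n : ℕ} (G : Graph n) (z : ℝ) (z>0 : 0ℝ ℝ.< z) (m : ℕ) where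
    open HardCore G z z>0
    open PartitionFunction G (seq z m)

    seq-∑weight : ∀ xs → seq (∑[ xs ] weight) m ≡ ∑ xs (λ I → seq z m ^ card I)
    seq-∑weight xs = trans (seq-∑ xs weight m) (∑-cong xs (λ I → seq-^ z (card I) m))

    seq-∑-containing : ∀ v → seq (∑[ filter (v ∈?_) independentSets ] weight) m + Z (⊤ - v) ≡ Z ⊤
    seq-∑-containing v = trans
      (cong (_+ Z (⊤ - v)) (seq-∑weight (filter (v ∈?_) independentSets))) (Z-containing v)

    seq-Pr : ∀ v {a} → Z ⊤ ≡ Z (⊤ - v) + a → seq (Pr (v ∈?_)) m ≡ a * recip (Z ⊤)
    seq-Pr v {a} Z⊤≡ = cong₂ (λ s t → s * recip t)
      (+-cancelʳ (Z (⊤ - v)) (seq (∑[ filter (v ∈?_) independentSets ] weight) m) a (trans (seq-∑-containing v) (trans Z⊤≡ (ℚ.+-comm (Z (⊤ - v)) a))))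
      (trans (seq-∑weight independentSets) Z-total)

    seq-occupancy : .{{_ : NonZero n}} → ∀ {a} → (∀ v → Z ⊤ ≡ Z (⊤ - v) + a) →
      seq occupancyFraction m ≡ a * recip (Z ⊤)
    seq-occupancy {a} Z⊤≡ =
      seq-average n _ m (a * recip (Z ⊤)) (λ v → seq-Pr v (Z⊤≡ v))

  eventually-≤ : ∀ x → ∃[ b ] (0ℚ < b × Eventually λ m → seq x m ≤ b)
  eventually-≤ x with N , close ← ℝ.cauchy x 1ℚ 0<1 = b , <b , N , bound
    where
    open ℚ.≤-Reasoning
    b : ℚ
    b = 1ℚ + ∣ seq x N ∣
    <b : 0ℚ < b
    <b = ℚ.<-≤-trans 0<1 (p≤p+q 1ℚ (ℚ.0≤∣p∣ (seq x N)))
    bound : ∀ m → N ℕ.≤ m → seq x m ≤ b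
    bound m N≤m = begin
      seq x m
        ≡⟨ solve 2 (λ s t → s := s :- t :+ t) refl (seq x m) (seq x N) ⟩
      seq x m − seq x N + seq x N
        ≤⟨ ℚ.+-mono-≤ (ℚ.≤-trans (p≤∣p∣ (seq x m − seq x N)) (ℚ.<⇒≤ (close m N N≤m ℕ.≤-refl))) (p≤∣p∣ (seq x N)) ⟩
      b ∎

  ≃-^ : ∀ {x y} k → x ℝ.≃ y ℝ.^ k → ∀ {ε} → 0ℚ < ε → Eventually λ m → ∣ seq x m − seq y m ^ k ∣ < ε
  ≃-^ {x} {y} k x≃y^k {ε} 0<ε with N , close ← x≃y^k ε 0<ε =
    N , λ m N≤m → subst (λ w → ∣ seq x m − w ∣ < ε) (seq-^ y k m) (close m N≤m)

  -- Real reciprocals are taken termwise, so both sides unfold to rational expressions by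
  -- computation, apart from the power.
  seq-tree-equation : ∀ {z α} d p r →
    (α ℝ./ (z ℝ.* (ℝ.1ℝ ℝ.- α)) [ p ]) ℝ.≃ ((ℝ.1ℝ ℝ.- ℝ.2ℝ ℝ.* α) ℝ./ (ℝ.1ℝ ℝ.- α) [ r ]) ℝ.^ d →
    ∀ {ε} → 0ℚ < ε → Eventually λ m →
      ∣ seq α m * recip (seq z m * (1ℚ − seq α m))
        − ((1ℚ − ℤ.+ 2 / 1 * seq α m) * recip (1ℚ − seq α m)) ^ d ∣ < ε
  seq-tree-equation {z} {α} d p r equation {ε} 0<ε
    with N , close ← ≃-^ {α ℝ./ (z ℝ.* (ℝ.1ℝ ℝ.- α)) [ p ]} {(ℝ.1ℝ ℝ.- ℝ.2ℝ ℝ.* α) ℝ./ (ℝ.1ℝ ℝ.- α) [ r ]}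
                       d equation 0<ε =
    N , λ m N≤m → subst₂ (λ x y → ∣ x − y ^ d ∣ < ε) (lhs m) (rhs m) (close m N≤m)
    where
    lhs : ∀ m → seq (α ℝ./ (z ℝ.* (ℝ.1ℝ ℝ.- α)) [ p ]) m ≡ seq α m * recip (seq z m * (1ℚ − seq α m))
    lhs m = refl
    rhs : ∀ m → seq ((ℝ.1ℝ ℝ.- ℝ.2ℝ ℝ.* α) ℝ./ (ℝ.1ℝ ℝ.- α) [ r ]) m ≡
                (1ℚ − ℤ.+ 2 / 1 * seq α m) * recip (1ℚ − seq α m)
    rhs m = refl

  module _ {d : ℕ} {z : ℝ} {z>0 : 0ℝ ℝ.< z} {α : ℝ} (tree : IsTreeOccupancy d z z>0 α) where
    open IsTreeOccupancy tree

    private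
      t s : ℕ → ℚ
      t = seq α
      s m = t m * recip (1ℚ − t m)

    -- Terms of `α` may exceed ½, but eventually by at most ε / 8. Then 1 - t is at least ⅜, and 1 -
    -- 2t is at least -ε / 4, hence at least -(1 - t) ε; dividing by 1 - t bounds 1 - s from below.
    tree-odds-bounds : ∀ {ε} → 0ℚ < ε → ε ≤ 1ℚ →
      Eventually λ m → ¼ ≤ 1ℚ − t m × neg ε ≤ 1ℚ − s m
    tree-odds-bounds {ε} 0<ε ε≤1 with N , t≤ ← α≤½ (⅛ * ε) (*-pos (ℚ.positive⁻¹ ⅛) 0<ε) =
      N , λ m N≤m → ¼≤ℓ m N≤m , -ε≤ m N≤m
      where
      open ℚ.≤-Reasoning
      ¼≤ℓ : ∀ m → N ℕ.≤ m → ¼ ≤ 1ℚ − t m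
      ¼≤ℓ m N≤m = begin
        ¼                            ≤⟨ ℚ.≤ᵇ⇒≤ _ ⟩
        1ℚ − (ℚ.½ + ⅛ * 1ℚ)          ≤⟨ ℚ.+-monoʳ-≤ 1ℚ (ℚ.neg-antimono-≤ (ℚ.≤-trans (t≤ m N≤m)
                                          (ℚ.+-monoʳ-≤ ℚ.½ (ℚ.*-monoˡ-≤-nonNeg ⅛ ε≤1)))) ⟩
        1ℚ − t m                     ∎
      -ε≤ : ∀ m → N ℕ.≤ m → neg ε ≤ 1ℚ − s m
      -ε≤ m N≤m = subst (neg ε ≤_) (1-odds {t m} 0<ℓ) (ℚ.*-cancelˡ-≤-pos ℓ {{positive 0<ℓ}} (begin
        ℓ * neg ε
          ≡⟨ solve 2 (λ ℓ ε → ℓ :* (:- ε) := :- (ℓ :* ε)) refl ℓ ε ⟩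
        neg (ℓ * ε)
          ≤⟨ ℚ.neg-antimono-≤ (ℚ.*-monoʳ-≤-nonNeg ε {{nonNegative (ℚ.<⇒≤ 0<ε)}} (¼≤ℓ m N≤m)) ⟩
        neg (¼ * ε)
          ≡⟨ solve 1 (λ ε → :- (con ¼ :* ε) := con 1ℚ :- con (ℤ.+ 2 / 1) :* (con ℚ.½ :+ con ⅛ :* ε)) refl ε ⟩
        1ℚ − ℤ.+ 2 / 1 * (ℚ.½ + ⅛ * ε)
          ≤⟨ ℚ.+-monoʳ-≤ 1ℚ (ℚ.neg-antimono-≤ (ℚ.*-monoˡ-≤-nonNeg (ℤ.+ 2 / 1) (t≤ m N≤m))) ⟩
        1ℚ − ℤ.+ 2 / 1 * t m
          ≡⟨ *-recip-cancelˡ (1ℚ − ℤ.+ 2 / 1 * t m) 0<ℓ ⟨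
        ℓ * (recip ℓ * (1ℚ − ℤ.+ 2 / 1 * t m))
          ≡⟨ cong (ℓ *_) (ℚ.*-comm (recip ℓ) (1ℚ − ℤ.+ 2 / 1 * t m)) ⟩
        ℓ * ((1ℚ − ℤ.+ 2 / 1 * t m) * recip ℓ) ∎))
        where
        ℓ : ℚ
        ℓ = 1ℚ − t m
        0<ℓ : 0ℚ < ℓ
        0<ℓ = ℚ.<-≤-trans (ℚ.positive⁻¹ ¼) (¼≤ℓ m N≤m)

    tree-odds-equation : ∀ {η b} → 0ℚ < η → 0ℚ < b →
      Eventually λ m → 0ℚ < seq z m → seq z m ≤ b → 0ℚ < 1ℚ − t m →
                       s m − seq z m * (1ℚ − s m) ^ d ≤ η
    tree-odds-equation 0<η 0<b
      with N , close ← seq-tree-equation {z} {α} d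
                         (ℝ.0<x*y {z} {ℝ.1ℝ ℝ.- α} z>0 (ℝ.0<1-α {α} α≤½)) (ℝ.0<1-α {α} α≤½)
                         equation (*-pos (recip-pos 0<b) 0<η) =
      N , λ m N≤m 0<q q≤b 0<ℓ → odds-equation {t m} 0<ℓ d 0<q q≤b 0<b 0<η (close m N≤m)

  tree<occupancy : ∀ {d z z>0 n α} .{{_ : NonZero n}} → 2 ℕ.≤ d → Fin n → (G : Graph n) →
    Graph.Regular G d → Graph.VertexTransitive G → Graph.Bipartite G →
    IsTreeOccupancy d z z>0 α → α ℝ.< HardCore.occupancyFraction G z z>0
  tree<occupancy {d} {z} {z>0} {n} {α} 2≤d v₀ G regular transitive (side , bipartite) tree =
    go z>0 (eventually-≤ z) (odds-separation d)
    where
    go : 0ℝ ℝ.< z → (∃[ b ] (0ℚ < b × Eventually λ m → seq z m ≤ b)) → OddsSeparation d →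
         α ℝ.< HardCore.occupancyFraction G z z>0
    go (δ , 0<δ , N₁ , δ≤) (b , 0<b , N₂ , ≤b) (L , 0≤L , separate) =
      ε * ⅛ , *-pos 0<ε (ℚ.positive⁻¹ ⅛) , N , bound
      where
      -- From these indices on the terms of `z` lie between `δ` and `b`.
      T : Set
      T = ∃[ m ] (N₁ ℕ.⊔ N₂ ℕ.≤ m)
      q : T → ℚ
      q (m , _) = seq z m
      δ≤q : ∀ τ → δ ≤ q τ
      δ≤q (m , ≤m) = subst (_≤ seq z m) (ℚ.+-identityˡ δ) (δ≤ m (ℕ.m⊔n≤o⇒m≤o N₁ N₂ ≤m))
      q≤b : ∀ τ → q τ ≤ b
      q≤b (m , ≤m) = ≤b m (ℕ.m⊔n≤o⇒n≤o N₁ N₂ ≤m)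
      open UniformGap G 2≤d regular transitive side bipartite q 0<δ δ≤q q≤b v₀
      open Correlation G side bipartite q 0<δ δ≤q q≤b using (0<q; 0<Z)

      -- `γ` is the uniform gap. One half of it covers the error in the tree equation, the other the
      -- Lipschitz loss ε κ. The choice ε = η / (κ + η) yields both ε κ < η and ε at most 1.
      γ η κ ε : ℚ
      γ = proj₁ odds-gap
      η = ℚ.½ * γ
      κ = 1ℚ + b * L
      ε = recip (κ + η) * η
      0<η : 0ℚ < η
      0<η = *-pos (ℚ.positive⁻¹ ℚ.½) (proj₁ (proj₂ odds-gap))
      0<κ : 0ℚ < κ
      0<κ = ℚ.<-≤-trans 0<1 (p≤p+q 1ℚ (*-nonNeg (ℚ.<⇒≤ 0<b) 0≤L))
      0<κ+η : 0ℚ < κ + η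
      0<κ+η = ℚ.<-≤-trans 0<κ (p≤p+q κ (ℚ.<⇒≤ 0<η))
      0<ε : 0ℚ < ε
      0<ε = *-pos (recip-pos 0<κ+η) 0<η
      ε[κ+η]≡η : ε * κ + ε * η ≡ η
      ε[κ+η]≡η = trans (solve 3 (λ r κ η → r :* η :* κ :+ r :* η :* η := (κ :+ η) :* (r :* η)) refl (recip (κ + η)) κ η)
                       (*-recip-cancelˡ η 0<κ+η)
      ε*κ<η : ε * κ < η
      ε*κ<η = subst₂ _<_ (ℚ.+-identityʳ (ε * κ)) ε[κ+η]≡η (ℚ.+-monoʳ-< (ε * κ) (*-pos 0<ε 0<η))
      ε≤1 : ε ≤ 1ℚ
      ε≤1 = ℚ.*-cancelˡ-≤-pos (κ + η) {{positive 0<κ+η}} (begin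
        (κ + η) * ε      ≡⟨ *-recip-cancelˡ η 0<κ+η ⟩
        η                ≤⟨ p≤p+q η (ℚ.<⇒≤ 0<κ) ⟩
        η + κ            ≡⟨ solve 2 (λ η κ → η :+ κ := (κ :+ η) :* con 1ℚ) refl η κ ⟩
        (κ + η) * 1ℚ     ∎)
        where open ℚ.≤-Reasoning

      bounds = tree-odds-bounds tree 0<ε ε≤1
      equation = tree-odds-equation tree 0<η 0<b
      N₃ N₄ N : ℕ
      N₃ = proj₁ bounds
      N₄ = proj₁ equation
      N = N₁ ℕ.⊔ N₂ ℕ.⊔ (N₃ ℕ.⊔ N₄)

      bound : ∀ m → N ℕ.≤ m → seq α m + ε * ⅛ ≤ seq (HardCore.occupancyFraction G z z>0) m
      -- The m-th term of the occupancy fraction is A / (Y + A) at the fugacity `seq z m`, so the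
      -- separation of the odds carries over through `odds-≤⇒≤`.
      bound m N≤m = subst (seq α m + ε * ⅛ ≤_)
        (sym (trans (seq-occupancy G z z>0 m {A τ} λ v → trans (Z⊤ τ) (cong (_+ A τ) (sym (Z[⊤-w]≡Y v τ))))
                    (cong (λ P → A τ * recip P) (Z⊤ τ))))
        (odds-≤⇒≤ {A τ} {Y τ} {seq α m} {ε} (0<Z τ (⊤ - v₀)) (0≤A τ) (A≤Y τ) (proj₁ bnds) (ℚ.<⇒≤ 0<ε)
          (separate {q τ} {b} {η} {ε} {odds τ} {seq α m * recip (1ℚ − seq α m)}
            (ℚ.<⇒≤ (0<q τ)) (q≤b τ) (ℚ.<⇒≤ 0<ε) ε≤1 ε*κ<η (0≤odds τ) (0≤1-odds τ)
            (subst (_≤ odds τ − q τ * (1ℚ − odds τ) ^ d)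
              (solve 1 (λ γ → γ := con ℚ.½ :* γ :+ con ℚ.½ :* γ) refl γ) (proj₂ (proj₂ odds-gap) τ))
            (proj₂ bnds)
            (proj₂ equation m (ℕ.m⊔n≤o⇒n≤o N₃ N₄ ≤₃₄) (0<q τ) (q≤b τ) (ℚ.<-≤-trans (ℚ.positive⁻¹ ¼) (proj₁ bnds)))))
        where
        τ : T
        τ = m , ℕ.m⊔n≤o⇒m≤o (N₁ ℕ.⊔ N₂) (N₃ ℕ.⊔ N₄) N≤m
        ≤₃₄ : N₃ ℕ.⊔ N₄ ℕ.≤ m
        ≤₃₄ = ℕ.m⊔n≤o⇒n≤o (N₁ ℕ.⊔ N₂) (N₃ ℕ.⊔ N₄) N≤m
        bnds = proj₂ bounds m (ℕ.m⊔n≤o⇒m≤o N₃ N₄ ≤₃₄)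

open import Defs

theorem2 : (d : ℕ) → 2 ℕ.≤ d → (z : ℝ) (z>0 : 0ℝ < z) →
    (n : ℕ) .{{_ : NonZero n}} (G : Graph n) →
    Graph.Regular G d → Graph.VertexTransitive G → Graph.Bipartite G →
    (α : ℝ) → IsTreeOccupancy d z z>0 α →
    α < HardCore.occupancyFraction G z z>0
-- The argument needs a base vertex. `NonZero` excludes the empty graph, and otherwise the vertex
-- `zero` serves.
theorem2 d 2≤d z z>0 zero = contradiction refl (ℕ.≢-nonZero⁻¹ 0)
theorem2 d 2≤d z z>0 (suc n) G regular transitive bipartite α tree =
  Termwise.tree<occupancy {α = α} 2≤d zero G regular transitive bipartite tree
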